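{- Let $E$ be an elliptic curve over $\mathbb{Q}$ such that $E(\mathbb{Q})[7]\neq\{0\}$. Assume moreover that the conductor of $E$ is $N_E=p^{\alpha}q^{\beta}$, where $p,q$ are distinct primes and $\alpha,\beta>0$ are integers. Then the minimal discriminant is $\Delta_E=-2^7\cdot 13$. In particular, $|\Delta_E|<N_E^3$, and Szpiro's conjecture holds for these curves: for every $\epsilon>0$ there is a constant $C_\epsilon$ such that $|\Delta_E|\le C_\epsilon N_E^{6+\epsilon}$ for every such $E$.
   Context: For an elliptic curve $E/\mathbb{Q}$, $\Delta_E$ denotes its minimal discriminant and $N_E$ its conductor. $E(\mathbb{Q})[7]$ is the subgroup of points of $E(\mathbb{Q})$ killed by multiplication by $7$. Szpiro's conjecture is the assertion that $|\Delta_E|\ll_{\epsilon}N_E^{6+\epsilon}$ for elliptic curves $E/\mathbb{Q}$. -}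

module Defs where

open import Algebra.Bundles.Raw using (RawRing)
open import Level using (0ℓ)
open import Algebra.Structures using (IsCommutativeRing)
import Algebra.Definitions.RawMonoid as RawMonoidDefs
import Algebra.Morphism.Structures as Morphisms
open import Data.Fin.Base using (Fin)
open import Data.Integer.Base as ℤ using (ℤ; +_; ∣_∣)
import Data.Integer.Divisibility as ℤᵈ
open import Data.List.Base using (List; length; applyUpTo)
open import Data.List.Membership.Propositional using (_∈_)
open import Data.List.Relation.Unary.Unique.Propositional using (Unique)
open import Data.Nat.Base as ℕ using (ℕ; zero; suc)
import Data.Nat.Divisibility as ℕᵈ
open import Data.Nat.ListAction using (sum)
open import Data.Nat.Primality using (Prime)
open import Data.Product.Base using (Σ; ∃; ∃-syntax; _×_; _,_)
open import Data.Rational.Base as ℚ using (ℚ; 0ℚ; 1ℚ; ↥_; ↧ₙ_)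
import Data.Rational.Properties as ℚ
open import Data.Sum.Base using (_⊎_)
open import Function.Bundles using (_⇔_)
open import Relation.Binary.Definitions using (DecidableEquality)
open import Relation.Binary.PropositionalEquality using (_≡_; _≢_)
open import Relation.Nullary using (¬_; yes; no)

HasCardinality : {A : Set} → (A → Set) → ℕ → Set
HasCardinality {A} P n =
  Σ (List A) λ xs → Unique xs × (∀ a → a ∈ xs ⇔ P a) × length xs ≡ n

-- Fields with decidable propositional equality.  (The HeytingField of the
-- library is setoid-based and has no operation of inversion.)
record Field : Set₁ where
  infix  8 -_
  infixl 7 _*_
  infixl 6 _+_ _-_
  field
    Carrier           : Set
    _+_ _*_           : Carrier → Carrier → Carrier
    -_                : Carrier → Carrier
    0# 1#             : Carrier
    isCommutativeRing : IsCommutativeRing _≡_ _+_ _*_ -_ 0# 1#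
    0#≢1#             : 0# ≢ 1#
    _≟_               : DecidableEquality Carrier
    inv               : ∀ x → .(x ≢ 0#) → Carrier
    *-inverse         : ∀ x (x≢0 : x ≢ 0#) → x * inv x x≢0 ≡ 1#

  rawRing : RawRing 0ℓ 0ℓ
  rawRing = record
    { Carrier = Carrier ; _≈_ = _≡_
    ; _+_ = _+_ ; _*_ = _*_ ; -_ = -_ ; 0# = 0# ; 1# = 1# }

  _-_ : Carrier → Carrier → Carrier
  x - y = x + (- y)

ℚ-field : Field
ℚ-field = record
  { Carrier = ℚ ; _+_ = ℚ._+_ ; _*_ = ℚ._*_ ; -_ = ℚ.-_ ; 0# = 0ℚ ; 1# = 1ℚ
  ; isCommutativeRing = ℚ.+-*-isCommutativeRing
  ; 0#≢1# = λ ()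
  ; _≟_ = ℚ._≟_
  ; inv = λ x x≢0 → ℚ.1/_ x {{ℚ.≢-nonZero x≢0}}
  ; *-inverse = λ x x≢0 → ℚ.*-inverseʳ x {{ℚ.≢-nonZero x≢0}}
  }

IsFieldHom : (K L : Field) → (Field.Carrier K → Field.Carrier L) → Set
IsFieldHom K L =
  Morphisms.RingMorphisms.IsRingHomomorphism (Field.rawRing K) (Field.rawRing L)

-- y² + a₁xy + a₃y = x³ + a₂x² + a₄x + a₆
record Weierstrass (A : Set) : Set where
  constructor weierstrass
  field a₁ a₂ a₃ a₄ a₆ : A

mapW : {A B : Set} → (A → B) → Weierstrass A → Weierstrass B
mapW f (weierstrass a₁ a₂ a₃ a₄ a₆) =
  weierstrass (f a₁) (f a₂) (f a₃) (f a₄) (f a₆)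

module Invariants (R : RawRing 0ℓ 0ℓ) where
  open RawRing R
  open RawMonoidDefs +-rawMonoid using () renaming (_×_ to _·_)

  private
    _-_ : Carrier → Carrier → Carrier
    x - y = x + (- y)
    infixl 6 _-_

  module _ (W : Weierstrass Carrier) where
    open Weierstrass W

    b₂ b₄ b₆ b₈ c₄ Δ : Carrier
    b₂ = a₁ * a₁ + 4 · a₂
    b₄ = 2 · a₄ + a₁ * a₃
    b₆ = a₃ * a₃ + 4 · a₆
    b₈ = a₁ * a₁ * a₆ + 4 · (a₂ * a₆) - a₁ * a₃ * a₄ + a₂ * a₃ * a₃ - a₄ * a₄
    c₄ = b₂ * b₂ - 24 · b₄
    Δ  = - (b₂ * b₂ * b₈) - 8 · (b₄ * b₄ * b₄) - 27 · (b₆ * b₆)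
         + 9 · (b₂ * b₄ * b₆)

module ℤ-Invariants = Invariants ℤ.+-*-rawRing

record EllipticCurve (K : Field) : Set where
  open Field K
  field
    equation    : Weierstrass Carrier
    nonsingular : Invariants.Δ rawRing equation ≢ 0#

module GroupLaw (K : Field) (W : Weierstrass (Field.Carrier K)) where
  open Field K
  open Weierstrass W
  open RawMonoidDefs (RawRing.+-rawMonoid rawRing) using () renaming (_×_ to _·_)

  data Point : Set where
    ∞      : Point
    affine : (x y : Carrier) → Point

  data OnCurve : Point → Set where
    ∞-on      : OnCurve ∞
    affine-on : ∀ {x y} →
      y * y + a₁ * x * y + a₃ * y ≡ x * x * x + a₂ * x * x + a₄ * x + a₆ →
      OnCurve (affine x y)

  -- The third point on the line of slope m through (x₁ , y₁) and a second
  -- point with abscissa x₂, reflected by (x , y) ↦ (x , - y - a₁x - a₃).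
  chord : (m x₁ y₁ x₂ : Carrier) → Point
  chord m x₁ y₁ x₂ = affine x₃ (- (m * (x₃ - x₁) + y₁) - a₁ * x₃ - a₃)
    where x₃ = m * m + a₁ * m - a₂ - x₁ - x₂

  -- Meaningful for points on the curve.  If x₁ = x₂, the second test asks
  -- whether the points are opposite; if they are not, then y₁ = y₂ and the
  -- tested quantity is 2y₁ + a₁x₁ + a₃, the denominator of the tangent slope.
  _⊕_ : Point → Point → Point
  ∞ ⊕ Q = Q
  P ⊕ ∞ = P
  affine x₁ y₁ ⊕ affine x₂ y₂ with (x₂ - x₁) ≟ 0#
  ... | no x₂-x₁≢0 = chord ((y₂ - y₁) * inv (x₂ - x₁) x₂-x₁≢0) x₁ y₁ x₂
  ... | yes _ with (y₁ + y₂ + a₁ * x₁ + a₃) ≟ 0#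
  ...   | yes _  = ∞
  ...   | no d≢0 = chord ((3 · (x₁ * x₁) + 2 · (a₂ * x₁) + a₄ - a₁ * y₁)
                          * inv (y₁ + y₂ + a₁ * x₁ + a₃) d≢0) x₁ y₁ x₂

  infixr 8 _⊙_
  _⊙_ : ℕ → Point → Point
  zero  ⊙ P = ∞
  suc n ⊙ P = P ⊕ (n ⊙ P)

  IsTorsion : ℕ → Point → Set
  IsTorsion n P = OnCurve P × n ⊙ P ≡ ∞

  act : (Carrier → Carrier) → Point → Point
  act f ∞            = ∞
  act f (affine x y) = affine (f x) (f y)

HasNontrivialTorsion : (n : ℕ) → EllipticCurve ℚ-field → Set
HasNontrivialTorsion n E = ∃[ P ] IsTorsion n P × P ≢ ∞
  where open GroupLaw ℚ-field (EllipticCurve.equation E)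

-- The substitution x = u²x′ + r, y = u³y′ + u²sx′ + t transforms W into W′.
record _≅_ (W W′ : Weierstrass ℚ) : Set where
  open Weierstrass W
  open Weierstrass W′ using ()
    renaming (a₁ to a₁′; a₂ to a₂′; a₃ to a₃′; a₄ to a₄′; a₆ to a₆′)
  open Field ℚ-field using (_+_; _*_; _-_)
  open RawMonoidDefs (RawRing.+-rawMonoid (Field.rawRing ℚ-field))
    using () renaming (_×_ to _·_)
  field
    u r s t : ℚ
    u≢0     : u ≢ 0ℚ
    eq₁ : u * a₁′ ≡ a₁ + 2 · s
    eq₂ : u * u * a₂′ ≡ a₂ - s * a₁ + 3 · r - s * s
    eq₃ : u * u * u * a₃′ ≡ a₃ + r * a₁ + 2 · t
    eq₄ : u * u * u * u * a₄′ ≡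
          a₄ - s * a₃ + 2 · (r * a₂) - (t + r * s) * a₁ + 3 · (r * r) - 2 · (s * t)
    eq₆ : u * u * u * u * u * u * a₆′ ≡
          a₆ + r * a₄ + r * r * a₂ + r * r * r - t * a₃ - t * t - r * t * a₁

IsIntegralModel : EllipticCurve ℚ-field → Weierstrass ℤ → Set
IsIntegralModel E W = EllipticCurve.equation E ≅ mapW (ℚ._/ 1) W

-- ord_p Δ(W) is least among the integral models of E.
IsMinimalModelAt : EllipticCurve ℚ-field → ℕ → Weierstrass ℤ → Set
IsMinimalModelAt E p W =
  IsIntegralModel E W ×
  (∀ W′ → IsIntegralModel E W′ → ∀ k →
    + (p ℕ.^ k) ℤᵈ.∣ ℤ-Invariants.Δ W → + (p ℕ.^ k) ℤᵈ.∣ ℤ-Invariants.Δ W′)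

-- Global minimal models exist because ℤ is a principal ideal domain, and their
-- discriminants agree, sign included, since the factor is a twelfth power.
IsGlobalMinimalModel : EllipticCurve ℚ-field → Weierstrass ℤ → Set
IsGlobalMinimalModel E W = ∀ p → Prime p → IsMinimalModelAt E p W

IsMinimalDiscriminant : EllipticCurve ℚ-field → ℤ → Set
IsMinimalDiscriminant E D =
  ∃[ W ] IsGlobalMinimalModel E W × ℤ-Invariants.Δ W ≡ D

-- A finite Galois extension L of ℚ: the fixed field of the finite set Aut(L)
-- is ℚ.
record GaloisExtension : Set₁ where
  field
    L          : Field
  open Field L public
  field
    ι          : ℚ → Carrier
    ι-hom      : IsFieldHom ℚ-field L ι
    degree     : ℕ
    σ          : Fin degree → Carrier → Carrier
    σ-hom      : ∀ i → IsFieldHom L L (σ i)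
    σ-distinct : ∀ i j → (∀ x → σ i x ≡ σ j x) → i ≡ j
    σ-complete : ∀ τ → IsFieldHom L L τ → ∃[ i ] ∀ x → τ x ≡ σ i x
    σ-fixed    : ∀ x → (∀ i → σ i x ≡ x) → ∃[ q ] ι q ≡ x

-- A normalised discrete valuation of L above p, with its ramification groups.
-- The value v 0# carries no information.
record PlaceAbove (G : GaloisExtension) (p : ℕ) : Set where
  open GaloisExtension G
  field
    v : Carrier → ℤ

  infix 4 _≤v_
  _≤v_ : ℤ → Carrier → Set
  m ≤v x = x ≢ 0# → m ℤ.≤ v x

  field
    v-*         : ∀ x y → x ≢ 0# → y ≢ 0# → v (x * y) ≡ v x ℤ.+ v y
    v-+         : ∀ m x y → m ≤v x → m ≤v y → m ≤v (x + y)
    uniformiser : ∃[ π ] π ≢ 0# × v π ≡ + 1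
    v-p         : + 1 ℤ.≤ v (ι (+ p ℚ./ 1))

  -- Lower numbering.  For i ≥ 0 such a σ k preserves the valuation ring, hence
  -- lies in the decomposition group, so these are the ramification groups of
  -- the completion of L over the p-adic numbers.
  InRamificationGroup : ℕ → Fin degree → Set
  InRamificationGroup i k = ∀ x → + 0 ≤v x → + suc i ≤v (σ k x - x)

-- δ is the wild part of the conductor exponent of E at p: for a prime ℓ ≠ p,
-- with L = ℚ(E[ℓ]), G_i the ramification groups of a place of L above p and
-- g_i = #G_i,
--   δ = Σ_{i ≥ 1} (g_i / g_0) dim_{𝔽_ℓ} (E[ℓ] / E[ℓ]^{G_i}),
-- where #E[ℓ] = ℓ² and #E[ℓ]^{G_i} = ℓ^(d i).
record IsWildExponent (E : EllipticCurve ℚ-field) (p δ : ℕ) : Set₁ where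
  field
    ℓ       : ℕ
    ℓ-prime : Prime ℓ
    ℓ≢p     : ℓ ≢ p
    G       : GaloisExtension
  open GaloisExtension G
  open GroupLaw L (mapW ι (EllipticCurve.equation E))
  field
    full-torsion : HasCardinality (IsTorsion ℓ) (ℓ ℕ.^ 2)
    generated    : ∀ k → (∀ P → IsTorsion ℓ P → act (σ k) P ≡ P) →
                   ∀ x → σ k x ≡ x
    place        : PlaceAbove G p
  open PlaceAbove place
  field
    g d     : ℕ → ℕ
    g-card  : ∀ i → HasCardinality (InRamificationGroup i) (g i)
    d-dim   : ∀ i → HasCardinality
                (λ P → IsTorsion ℓ P ×
                       (∀ k → InRamificationGroup i k → act (σ k) P ≡ P))
                (ℓ ℕ.^ d i)
    M       : ℕ
    trivial : ∀ i → M ℕ.< i → g i ≡ 1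
    formula : δ ℕ.* g 0 ≡ sum (applyUpTo (λ i → g (suc i) ℕ.* (2 ℕ.∸ d (suc i))) M)

-- The wild part vanishes for good and for multiplicative reduction (and for
-- every p ≥ 5), so it enters only in the additive case.
data IsConductorExponent (E : EllipticCurve ℚ-field) (p : ℕ) : ℕ → Set₁ where
  good           : ∀ W → IsMinimalModelAt E p W →
                   ¬ (+ p ℤᵈ.∣ ℤ-Invariants.Δ W) →
                   IsConductorExponent E p 0
  multiplicative : ∀ W → IsMinimalModelAt E p W →
                   + p ℤᵈ.∣ ℤ-Invariants.Δ W → ¬ (+ p ℤᵈ.∣ ℤ-Invariants.c₄ W) →
                   IsConductorExponent E p 1
  additive       : ∀ W δ → IsMinimalModelAt E p W →
                   + p ℤᵈ.∣ ℤ-Invariants.Δ W → + p ℤᵈ.∣ ℤ-Invariants.c₄ W →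
                   IsWildExponent E p δ →
                   IsConductorExponent E p (2 ℕ.+ δ)

-- N = ∏ p^(f_p); the last condition also excludes N = 0.
IsConductor : EllipticCurve ℚ-field → ℕ → Set₁
IsConductor E N = ∀ p → Prime p →
  ∃[ f ] IsConductorExponent E p f × p ℕ.^ f ℕᵈ.∣ N × ¬ (p ℕ.^ suc f ℕᵈ.∣ N)

IsTwoPrimeProduct : ℕ → Set
IsTwoPrimeProduct N =
  ∃[ p ] ∃[ q ] ∃[ α ] ∃[ β ]
    Prime p × Prime q × p ≢ q × α ℕ.> 0 × β ℕ.> 0 × N ≡ p ℕ.^ α ℕ.* q ℕ.^ β

record ℝ : Set₁ where
  field
    Lower Upper     : ℚ → Set
    lower-inhabited : ∃ Lower
    upper-inhabited : ∃ Upper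
    lower-rounded   : ∀ q → Lower q ⇔ (∃[ r ] q ℚ.< r × Lower r)
    upper-rounded   : ∀ q → Upper q ⇔ (∃[ r ] r ℚ.< q × Upper r)
    disjoint        : ∀ q → ¬ (Lower q × Upper q)
    located         : ∀ q r → q ℚ.< r → Lower q ⊎ Upper r

Positive : ℝ → Set
Positive ε = ℝ.Lower ε 0ℚ

-- x ≤ C · N^(k + ε), for N ≥ 1 and ε > 0: since N^(k + ε) is the infimum of
-- the N^(k + r) over the rationals r = a/b > ε, this says
-- x^b ≤ C^b · N^(kb + a) for all of these.
PowerBound : (x C N k : ℕ) → ℝ → Set
PowerBound x C N k ε = ∀ r → ℝ.Upper ε r →
  x ℕ.^ ↧ₙ r ℕ.≤ C ℕ.^ ↧ₙ r ℕ.* N ℕ.^ (k ℕ.* ↧ₙ r ℕ.+ ∣ ↥ r ∣)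

{-# OPTIONS --safe #-}

-- A curve with a rational point of order 7 is a Tate curve with a parameter
-- a/b in lowest terms.  Put c = a - b; the integral model obtained from it has
-- discriminant (abc)⁷ f, where f = a³ - 8a²b + 5ab² + b³, and it is minimal,
-- because no prime p satisfies both p¹² ∣ Δ and p⁴ ∣ c₄: p divides just one of
-- a, b, c, f; in the first three cases p ∤ c₄, and in the last one a Bézout
-- identity gives p⁴ ∣ 49.  Hence every prime dividing abcf divides the
-- conductor.  If neither of the two primes of the conductor divides f, then
-- f = ±1; one of the pairwise coprime integers a, b, c is divisible by neither
-- prime, so it is ±1 as well, and f = ±1 becomes a cubic equation in one
-- unknown, without suitable solutions.  Otherwise one of the primes divides f,
-- the other one is 2, because one of a, b, c is even, and the remaining two of
-- a, b, c are ±1; this leaves Δ = -2⁷·13.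
module Submission where

open import Defs
open import Algebra.Bundles.Raw using (RawRing)
import Algebra.Definitions.RawMonoid as RawMonoidDefs
import Algebra.Properties.CommutativeSemiring.Exp as Exp
import Algebra.Solver.Ring as RingSolver
import Algebra.Solver.Ring.AlmostCommutativeRing as ACR
open import Data.Empty using (⊥; ⊥-elim)
open import Data.Fin using (Fin; zero; suc; toℕ; #_)
open import Data.Integer.Base as ℤ using (ℤ; +_; -[1+_])
open import Data.Integer.DivMod using (_/ℕ_; _%ℕ_; a≡a%ℕn+[a/ℕn]*n; n%ℕd<d)
import Data.Integer.Divisibility.Signed as ℤᵈ
import Data.Integer.Properties as ℤ
import Data.Integer.Solver as ℤSolver
open import Data.List.Base using ([]; _∷_)
open import Data.List.Relation.Unary.All using ([]; _∷_)
import Data.Maybe.Base as Maybe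
open import Data.Nat.Base as ℕ using (ℕ; zero; suc; z≤n; s≤s)
import Data.Nat.Coprimality as Coprimality
import Data.Nat.Divisibility as ℕᵈ
open import Data.Nat.Primality
  using ( Prime; euclidsLemma; prime[2]; prime?; ¬prime[1]; prime⇒irreducible; prime⇒nonTrivial
        ; prime⇒nonZero )
open import Data.Nat.Primality.Factorisation using (factorise)
import Data.Nat.Properties as ℕ
open import Data.Product.Base using (∃-syntax; _×_; _,_; proj₁; proj₂)
open import Data.Rational.Base as ℚ using (ℚ; 0ℚ; 1ℚ; mkℚ)
import Data.Rational.Properties as ℚ
open import Data.Rational.Unnormalised.Base as ℚᵘ using (mkℚᵘ; *≡*)
import Data.Rational.Unnormalised.Properties as ℚᵘ
open import Data.Sum.Base as Sum using (_⊎_; inj₁; inj₂; [_,_]′)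
open import Data.Vec.Base as Vec using (Vec; []; _∷_; lookup)
open import Data.Vec.Properties using (lookup-map)
open import Function.Base using (id; _∘_)
open import Level using (0ℓ)
open import Relation.Binary.PropositionalEquality
open import Relation.Nullary using (¬_; Dec; yes; no; contradiction)
open import Relation.Nullary.Decidable
  using (dec⇒maybe; decidable-stable; from-no; from-yes; ¬?; _→-dec_; _×-dec_; _⊎-dec_)

-- The embedding of ℤ in ℚ, and ring solvers

ι : ℤ → ℚ
ι i = i ℚ./ 1

toℚᵘ-ι : ∀ i → ℚ.toℚᵘ (ι i) ℚᵘ.≃ mkℚᵘ i 0
toℚᵘ-ι i = ℚ.toℚᵘ-fromℚᵘ (mkℚᵘ i 0)

ι-homo-+ : ∀ i j → ι (i ℤ.+ j) ≡ ι i ℚ.+ ι j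
ι-homo-+ i j = ℚ.toℚᵘ-injective (begin
  ℚ.toℚᵘ (ι (i ℤ.+ j))            ≈⟨ toℚᵘ-ι (i ℤ.+ j) ⟩
  mkℚᵘ (i ℤ.+ j) 0                ≈⟨ *≡* (cong (ℤ._* + 1) (sym i*1+j*1≡i+j)) ⟩
  mkℚᵘ i 0 ℚᵘ.+ mkℚᵘ j 0          ≈⟨ ℚᵘ.+-cong (toℚᵘ-ι i) (toℚᵘ-ι j) ⟨
  ℚ.toℚᵘ (ι i) ℚᵘ.+ ℚ.toℚᵘ (ι j)  ≈⟨ ℚ.toℚᵘ-homo-+ (ι i) (ι j) ⟨
  ℚ.toℚᵘ (ι i ℚ.+ ι j)            ∎)
  where
  open ℚᵘ.≃-Reasoning

  i*1+j*1≡i+j : i ℤ.* + 1 ℤ.+ j ℤ.* + 1 ≡ i ℤ.+ j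
  i*1+j*1≡i+j = cong₂ ℤ._+_ (ℤ.*-identityʳ i) (ℤ.*-identityʳ j)

ι-homo-* : ∀ i j → ι (i ℤ.* j) ≡ ι i ℚ.* ι j
ι-homo-* i j = ℚ.toℚᵘ-injective (begin
  ℚ.toℚᵘ (ι (i ℤ.* j))            ≈⟨ toℚᵘ-ι (i ℤ.* j) ⟩
  mkℚᵘ i 0 ℚᵘ.* mkℚᵘ j 0          ≈⟨ ℚᵘ.*-cong (toℚᵘ-ι i) (toℚᵘ-ι j) ⟨
  ℚ.toℚᵘ (ι i) ℚᵘ.* ℚ.toℚᵘ (ι j)  ≈⟨ ℚ.toℚᵘ-homo-* (ι i) (ι j) ⟨
  ℚ.toℚᵘ (ι i ℚ.* ι j)            ∎)
  where open ℚᵘ.≃-Reasoning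

ι-homo‿- : ∀ i → ι (ℤ.- i) ≡ ℚ.- ι i
ι-homo‿- i = ℚ.toℚᵘ-injective (begin
  ℚ.toℚᵘ (ι (ℤ.- i))   ≈⟨ toℚᵘ-ι (ℤ.- i) ⟩
  ℚᵘ.- mkℚᵘ i 0        ≈⟨ ℚᵘ.-‿cong (toℚᵘ-ι i) ⟨
  ℚᵘ.- ℚ.toℚᵘ (ι i)    ≈⟨ ℚ.toℚᵘ-homo‿- (ι i) ⟨
  ℚ.toℚᵘ (ℚ.- ι i)     ∎)
  where open ℚᵘ.≃-Reasoning

ι-injective : ∀ {i j} → ι i ≡ ι j → i ≡ j
ι-injective {i} {j} eq with ℚ.fromℚᵘ-injective {mkℚᵘ i 0} {mkℚᵘ j 0} eq
... | *≡* e = ℤ.*-cancelʳ-≡ i j (+ 1) e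

ℚ-ring : ACR.AlmostCommutativeRing 0ℓ 0ℓ
ℚ-ring = ACR.fromCommutativeRing ℚ.+-*-commutativeRing

ι-morphism : ℤ.+-*-rawRing ACR.-Raw-AlmostCommutative⟶ ℚ-ring
ι-morphism = record
  { ⟦_⟧    = ι
  ; +-homo = ι-homo-+
  ; *-homo = ι-homo-*
  ; -‿homo = ι-homo‿-
  ; 0-homo = refl
  ; 1-homo = refl
  }

-- Coefficients are integers, read as rationals through `ι`, so that normal forms are computed in ℤ.
module ℚ-Solver = RingSolver ℤ.+-*-rawRing ℚ-ring ι-morphism
  (λ i j → Maybe.map (cong ι) (dec⇒maybe (i ℤ.≟ j)))

module ℤ-Solver = ℤSolver.+-*-Solver

-- The syntax of the solver as a raw ring: instantiating `Invariants` with it yields `Δ` and `c₄` as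
-- polynomials, without writing them out again.
ℚ-polynomials : ℕ → RawRing 0ℓ 0ℓ
ℚ-polynomials n = record
  { Carrier = Polynomial n ; _≈_ = _≡_ ; _+_ = _:+_ ; _*_ = _:*_ ; -_ = :-_
  ; 0# = con (+ 0) ; 1# = con (+ 1) }
  where open ℚ-Solver

ℤ-polynomials : ℕ → RawRing 0ℓ 0ℓ
ℤ-polynomials n = record
  { Carrier = Polynomial n ; _≈_ = _≡_ ; _+_ = _:+_ ; _*_ = _:*_ ; -_ = :-_
  ; 0# = con (+ 0) ; 1# = con (+ 1) }
  where open ℤ-Solver

module ℚ-Poly {n} = Invariants (ℚ-polynomials n)
module ℤ-Poly {n} = Invariants (ℤ-polynomials n)

module ℚ-Invariants = Invariants (Field.rawRing ℚ-field)

-- Substitutions and Tate's models over an arbitrary ring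

module Substitution (R : RawRing 0ℓ 0ℓ) where
  open RawRing R
  open RawMonoidDefs +-rawMonoid using () renaming (_×_ to _·_)

  private
    _-_ : Carrier → Carrier → Carrier
    x - y = x + (- y)
    infixl 6 _-_

  scale : Carrier → Weierstrass Carrier → Weierstrass Carrier
  scale u (weierstrass a₁ a₂ a₃ a₄ a₆) =
    weierstrass (u * a₁) (u * u * a₂) (u * u * u * a₃) (u * u * u * u * a₄)
      (u * u * u * u * u * u * a₆)

  shift : (r s t : Carrier) → Weierstrass Carrier → Weierstrass Carrier
  shift r s t (weierstrass a₁ a₂ a₃ a₄ a₆) =
    weierstrass
      (a₁ + 2 · s)
      (a₂ - s * a₁ + 3 · r - s * s)
      (a₃ + r * a₁ + 2 · t)
      (a₄ - s * a₃ + 2 · (r * a₂) - (t + r * s) * a₁ + 3 · (r * r) - 2 · (s * t))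
      (a₆ + r * a₄ + r * r * a₂ + r * r * r - t * a₃ - t * t - r * t * a₁)

module Tate (R : RawRing 0ℓ 0ℓ) where
  open RawRing R

  private
    _-_ : Carrier → Carrier → Carrier
    x - y = x + (- y)
    infixl 6 _-_

  -- The model of Tate's normal form with parameter a / b, scaled by b².
  tateModel : Carrier → Carrier → Weierstrass Carrier
  tateModel a b =
    weierstrass (b * b + a * b - a * a) (a * a * b * (b - a)) (b * b * (a * a * b * (b - a))) 0# 0#

open Tate ℤ.+-*-rawRing using (tateModel)
module ℚ-PolyTate {n} = Tate (ℚ-polynomials n)
module ℚ-PolySub {n} = Substitution (ℚ-polynomials n)

open Exp (ACR.AlmostCommutativeRing.commutativeSemiring ℚ-ring) using () renaming (_^_ to _^ℚ_)

-- Changes of Weierstrass models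

module ModelChange where
  open import Data.Rational.Base using (_+_; _*_; _-_)
  open Exp (ACR.AlmostCommutativeRing.commutativeSemiring ℚ-ring) using (_^_; ^-distrib-*)
  open ℚ-Solver
  open ℚ-Invariants
  open Substitution (Field.rawRing ℚ-field)

  -- Lets the solver use a hypothesis: with the right k, x ≡ y + k (l - r) is
  -- an identity of polynomials.
  eliminate : ∀ {x y l r : ℚ} k → l ≡ r → x ≡ y + k * (l - r) → x ≡ y
  eliminate {x} {y} {l} {r} k refl eq = begin
    x                ≡⟨ eq ⟩
    y + k * (l - l)  ≡⟨ cong (λ z → y + k * z) (ℚ.+-inverseʳ l) ⟩
    y + k * 0ℚ       ≡⟨ cong (λ z → y + z) (ℚ.*-zeroʳ k) ⟩
    y + 0ℚ           ≡⟨ ℚ.+-identityʳ y ⟩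
    y                ∎
    where open ≡-Reasoning

  Δ-shift : ∀ r s t W → Δ (shift r s t W) ≡ Δ W
  Δ-shift r s t (weierstrass a₁ a₂ a₃ a₄ a₆) =
    solve 8 (λ r s t a₁ a₂ a₃ a₄ a₆ →
      ℚ-Poly.Δ (ℚ-PolySub.shift r s t (weierstrass a₁ a₂ a₃ a₄ a₆)) :=
      ℚ-Poly.Δ (weierstrass a₁ a₂ a₃ a₄ a₆))
      refl r s t a₁ a₂ a₃ a₄ a₆

  c₄-shift : ∀ r s t W → c₄ (shift r s t W) ≡ c₄ W
  c₄-shift r s t (weierstrass a₁ a₂ a₃ a₄ a₆) =
    solve 8 (λ r s t a₁ a₂ a₃ a₄ a₆ →
      ℚ-Poly.c₄ (ℚ-PolySub.shift r s t (weierstrass a₁ a₂ a₃ a₄ a₆)) :=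
      ℚ-Poly.c₄ (weierstrass a₁ a₂ a₃ a₄ a₆))
      refl r s t a₁ a₂ a₃ a₄ a₆

  Δ-scale : ∀ u W → Δ (scale u W) ≡ u ^ 12 * Δ W
  Δ-scale u (weierstrass a₁ a₂ a₃ a₄ a₆) =
    solve 6 (λ u a₁ a₂ a₃ a₄ a₆ →
      ℚ-Poly.Δ (ℚ-PolySub.scale u (weierstrass a₁ a₂ a₃ a₄ a₆)) :=
      u :^ 12 :* ℚ-Poly.Δ (weierstrass a₁ a₂ a₃ a₄ a₆))
      refl u a₁ a₂ a₃ a₄ a₆

  c₄-scale : ∀ u W → c₄ (scale u W) ≡ u ^ 4 * c₄ W
  c₄-scale u (weierstrass a₁ a₂ a₃ a₄ a₆) =
    solve 6 (λ u a₁ a₂ a₃ a₄ a₆ →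
      ℚ-Poly.c₄ (ℚ-PolySub.scale u (weierstrass a₁ a₂ a₃ a₄ a₆)) :=
      u :^ 4 :* ℚ-Poly.c₄ (weierstrass a₁ a₂ a₃ a₄ a₆))
      refl u a₁ a₂ a₃ a₄ a₆

  weierstrass-cong : ∀ {A : Set} {a₁ a₂ a₃ a₄ a₆ a₁′ a₂′ a₃′ a₄′ a₆′ : A} →
    a₁ ≡ a₁′ → a₂ ≡ a₂′ → a₃ ≡ a₃′ → a₄ ≡ a₄′ → a₆ ≡ a₆′ →
    weierstrass a₁ a₂ a₃ a₄ a₆ ≡ weierstrass a₁′ a₂′ a₃′ a₄′ a₆′
  weierstrass-cong refl refl refl refl refl = refl

  -- Splits a change of model into a translation, which fixes `Δ` and `c₄`, and a scaling, which
  -- multiplies them by the 12th and 4th powers of `u`.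
  ≅⇒scale≡shift : ∀ {W W′} (i : W ≅ W′) → let open _≅_ i in scale u W′ ≡ shift r s t W
  ≅⇒scale≡shift i = weierstrass-cong eq₁ eq₂ eq₃ eq₄ eq₆
    where open _≅_ i

  Δ-≅ : ∀ {W W′} (i : W ≅ W′) → _≅_.u i ^ 12 * Δ W′ ≡ Δ W
  Δ-≅ {W} {W′} i = trans (sym (Δ-scale u W′)) (trans (cong Δ (≅⇒scale≡shift i)) (Δ-shift r s t W))
    where open _≅_ i

  c₄-≅ : ∀ {W W′} (i : W ≅ W′) → _≅_.u i ^ 4 * c₄ W′ ≡ c₄ W
  c₄-≅ {W} {W′} i = trans (sym (c₄-scale u W′)) (trans (cong c₄ (≅⇒scale≡shift i)) (c₄-shift r s t W))
    where open _≅_ i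

  -- Invariants of integral models inside ℚ

  evalℤ : ∀ {n} → Polynomial n → Vec ℤ n → ℤ
  evalℤ (op [+] p q) ρ = evalℤ p ρ ℤ.+ evalℤ q ρ
  evalℤ (op [*] p q) ρ = evalℤ p ρ ℤ.* evalℤ q ρ
  evalℤ (con c)      ρ = c
  evalℤ (var x)      ρ = lookup ρ x
  evalℤ (p :^ n)     ρ = evalℤ p ρ ℤ.^ n
  evalℤ (:- p)       ρ = ℤ.- evalℤ p ρ

  ι-homo-^ : ∀ i n → ι (i ℤ.^ n) ≡ ι i ^ n
  ι-homo-^ i zero    = refl
  ι-homo-^ i (suc n) = trans (ι-homo-* i (i ℤ.^ n)) (cong (ι i *_) (ι-homo-^ i n))

  ι-evalℤ : ∀ {n} (p : Polynomial n) ρ → ⟦ p ⟧ (Vec.map ι ρ) ≡ ι (evalℤ p ρ)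
  ι-evalℤ (op [+] p q) ρ =
    trans (cong₂ _+_ (ι-evalℤ p ρ) (ι-evalℤ q ρ)) (sym (ι-homo-+ (evalℤ p ρ) (evalℤ q ρ)))
  ι-evalℤ (op [*] p q) ρ =
    trans (cong₂ _*_ (ι-evalℤ p ρ) (ι-evalℤ q ρ)) (sym (ι-homo-* (evalℤ p ρ) (evalℤ q ρ)))
  ι-evalℤ (con c)  ρ = refl
  ι-evalℤ (var x)  ρ = lookup-map x ι ρ
  ι-evalℤ (p :^ n) ρ = trans (cong (_^ n) (ι-evalℤ p ρ)) (sym (ι-homo-^ (evalℤ p ρ) n))
  ι-evalℤ (:- p)   ρ = trans (cong ℚ.-_ (ι-evalℤ p ρ)) (sym (ι-homo‿- (evalℤ p ρ)))

  generic : Weierstrass (Polynomial 5)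
  generic = weierstrass (var (# 0)) (var (# 1)) (var (# 2)) (var (# 3)) (var (# 4))

  coefficients : ∀ {A : Set} → Weierstrass A → Vec A 5
  coefficients (weierstrass a₁ a₂ a₃ a₄ a₆) = a₁ ∷ a₂ ∷ a₃ ∷ a₄ ∷ a₆ ∷ []

  -- Both sides unfold to the evaluations of the polynomial `ℚ-Poly.Δ generic` that `ι-evalℤ`
  -- compares.
  Δ-mapW-ι : ∀ W → Δ (mapW ι W) ≡ ι (ℤ-Invariants.Δ W)
  Δ-mapW-ι W = ι-evalℤ (ℚ-Poly.Δ generic) (coefficients W)

  c₄-mapW-ι : ∀ W → c₄ (mapW ι W) ≡ ι (ℤ-Invariants.c₄ W)
  c₄-mapW-ι W = ι-evalℤ (ℚ-Poly.c₄ generic) (coefficients W)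

  *-denominator : ∀ q → q * ι (ℚ.↧ q) ≡ ι (ℚ.↥ q)
  *-denominator q@record{} = ℚ.toℚᵘ-injective (begin
    ℚ.toℚᵘ (q * ι (ℚ.↧ q))            ≈⟨ ℚ.toℚᵘ-homo-* q (ι (ℚ.↧ q)) ⟩
    ℚ.toℚᵘ q ℚᵘ.* ℚ.toℚᵘ (ι (ℚ.↧ q))  ≈⟨ ℚᵘ.*-congˡ {ℚ.toℚᵘ q} (toℚᵘ-ι (ℚ.↧ q)) ⟩
    ℚ.toℚᵘ q ℚᵘ.* mkℚᵘ (ℚ.↧ q) 0      ≈⟨ *≡* (ℤ.*-assoc (ℚ.↥ q) (ℚ.↧ q) (+ 1)) ⟩
    mkℚᵘ (ℚ.↥ q) 0                    ≈⟨ toℚᵘ-ι (ℚ.↥ q) ⟨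
    ℚ.toℚᵘ (ι (ℚ.↥ q))                ∎)
    where open ℚᵘ.≃-Reasoning

  coprime-↥-↧ₙ : ∀ q → Coprimality.Coprime ℤ.∣ ℚ.↥ q ∣ (ℚ.↧ₙ q)
  coprime-↥-↧ₙ (mkℚ n d-1 c) = Coprimality.recompute c

  -- m / n = u / u′ in lowest terms, for the scaling factors u, u′ of the models.
  record Comparison (W W′ : Weierstrass ℤ) : Set where
    field
      m        : ℤ
      n        : ℕ
      coprime  : Coprimality.Coprime ℤ.∣ m ∣ n
      Δ-ratio  : m ℤ.^ 12 ℤ.* ℤ-Invariants.Δ W ≡ (+ n) ℤ.^ 12 ℤ.* ℤ-Invariants.Δ W′
      c₄-ratio : m ℤ.^ 4 ℤ.* ℤ-Invariants.c₄ W ≡ (+ n) ℤ.^ 4 ℤ.* ℤ-Invariants.c₄ W′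

  compare : ∀ E W W′ → IsIntegralModel E W → IsIntegralModel E W′ → Comparison W W′
  compare E W W′ i i′ = record
    { m = ℚ.↥ v ; n = ℚ.↧ₙ v ; coprime = coprime-↥-↧ₙ v
    ; Δ-ratio  = clear 12 (ℤ-Invariants.Δ W) (ℤ-Invariants.Δ W′) (begin
        u ^ 12 * ι (ℤ-Invariants.Δ W)    ≡⟨ cong (u ^ 12 *_) (Δ-mapW-ι W) ⟨
        u ^ 12 * Δ (mapW ι W)            ≡⟨ Δ-≅ i ⟩
        Δ (EllipticCurve.equation E)     ≡⟨ Δ-≅ i′ ⟨
        u′ ^ 12 * Δ (mapW ι W′)          ≡⟨ cong (u′ ^ 12 *_) (Δ-mapW-ι W′) ⟩
        u′ ^ 12 * ι (ℤ-Invariants.Δ W′)  ∎)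
    ; c₄-ratio = clear 4 (ℤ-Invariants.c₄ W) (ℤ-Invariants.c₄ W′) (begin
        u ^ 4 * ι (ℤ-Invariants.c₄ W)    ≡⟨ cong (u ^ 4 *_) (c₄-mapW-ι W) ⟨
        u ^ 4 * c₄ (mapW ι W)            ≡⟨ c₄-≅ i ⟩
        c₄ (EllipticCurve.equation E)    ≡⟨ c₄-≅ i′ ⟨
        u′ ^ 4 * c₄ (mapW ι W′)          ≡⟨ cong (u′ ^ 4 *_) (c₄-mapW-ι W′) ⟩
        u′ ^ 4 * ι (ℤ-Invariants.c₄ W′)  ∎)
    }
    where
    open ≡-Reasoning
    open _≅_ i using (u)
    open _≅_ i′ using () renaming (u to u′; u≢0 to u′≢0)
    w v : ℚ
    w = Field.inv ℚ-field u′ u′≢0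
    v = w * u

    -- Multiplying by `w ^ k` turns the two scaling factors into their ratio `v`, and multiplying by
    -- `n ^ k` clears the denominator of `v`.
    clear : ∀ k D D′ → u ^ k * ι D ≡ u′ ^ k * ι D′ → ℚ.↥ v ℤ.^ k ℤ.* D ≡ ℚ.↧ v ℤ.^ k ℤ.* D′
    clear k D D′ eq = ι-injective (begin
      ι (ℚ.↥ v ℤ.^ k ℤ.* D)                ≡⟨ ι-homo-* (ℚ.↥ v ℤ.^ k) D ⟩
      ι (ℚ.↥ v ℤ.^ k) * ι D                ≡⟨ cong (_* ι D) (ι-homo-^ (ℚ.↥ v) k) ⟩
      ι (ℚ.↥ v) ^ k * ι D                  ≡⟨ cong (λ x → x ^ k * ι D) (*-denominator v) ⟨
      (w * u * n) ^ k * ι D                ≡⟨ cong (_* ι D) (^-distrib-* (w * u) n k) ⟩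
      (w * u) ^ k * n ^ k * ι D            ≡⟨ cong (λ x → x * n ^ k * ι D) (^-distrib-* w u k) ⟩
      w ^ k * u ^ k * n ^ k * ι D          ≡⟨ solve 4 (λ w u n D →
                                                   w :* u :* n :* D := w :* n :* (u :* D))
                                                 refl (w ^ k) (u ^ k) (n ^ k) (ι D) ⟩
      w ^ k * n ^ k * (u ^ k * ι D)        ≡⟨ cong (w ^ k * n ^ k *_) eq ⟩
      w ^ k * n ^ k * (u′ ^ k * ι D′)      ≡⟨ solve 4 (λ w u n D →
                                                   w :* n :* (u :* D) := u :* w :* n :* D)
                                                 refl (w ^ k) (u′ ^ k) (n ^ k) (ι D′) ⟩
      u′ ^ k * w ^ k * n ^ k * ι D′        ≡⟨ cong (λ x → x * n ^ k * ι D′) (^-distrib-* u′ w k) ⟨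
      (u′ * w) ^ k * n ^ k * ι D′          ≡⟨ cong (λ x → x ^ k * n ^ k * ι D′) (Field.*-inverse ℚ-field u′ u′≢0) ⟩
      1ℚ ^ k * n ^ k * ι D′                ≡⟨ cong (_* ι D′) (^-distrib-* 1ℚ n k) ⟨
      (1ℚ * n) ^ k * ι D′                  ≡⟨ cong (λ x → x ^ k * ι D′) (ℚ.*-identityˡ n) ⟩
      n ^ k * ι D′                         ≡⟨ cong (_* ι D′) (ι-homo-^ (ℚ.↧ v) k) ⟨
      ι (ℚ.↧ v ℤ.^ k) * ι D′               ≡⟨ ι-homo-* (ℚ.↧ v ℤ.^ k) D′ ⟨
      ι (ℚ.↧ v ℤ.^ k ℤ.* D′)               ∎)
      where
      n : ℚ
      n = ι (ℚ.↧ v)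

open ModelChange

-- Points of order 7

module SevenTorsion where
  open Field ℚ-field using (_+_; _*_; _-_; -_; inv; _≟_; *-inverse)
  open ℚ-Solver

  *-cancelˡ-≢0 : ∀ {x y z} → x ≢ 0ℚ → x * y ≡ x * z → y ≡ z
  *-cancelˡ-≢0 {x} {y} {z} x≢0 eq = eliminate (inv x x≢0) eq (eliminate (z - y) (*-inverse x x≢0)
    (solve 4 (λ x i y z →
      y := z :+ i :* (x :* y :- x :* z) :+ (z :- y) :* (x :* i :- con (+ 1)))
      refl x (inv x x≢0) y z))

  x*y≡0⇒y≡0 : ∀ {x y} → x ≢ 0ℚ → x * y ≡ 0ℚ → y ≡ 0ℚ
  x*y≡0⇒y≡0 {x} x≢0 eq = *-cancelˡ-≢0 x≢0 (trans eq (sym (ℚ.*-zeroʳ x)))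

  x*y≢0⇒y≢0 : ∀ {x y} → x * y ≢ 0ℚ → y ≢ 0ℚ
  x*y≢0⇒y≢0 {x} xy≢0 refl = xy≢0 (ℚ.*-zeroʳ x)

  module Multiples (W : Weierstrass ℚ) (x₀ y₀ : ℚ) where
    open Weierstrass W
    open GroupLaw ℚ-field W
    open RawMonoidDefs (RawRing.+-rawMonoid (Field.rawRing ℚ-field)) using () renaming (_×_ to _·_)

    P : Point
    P = affine x₀ y₀

    -- Both the denominator of the slope of the tangent at `P` and the coefficient of Y in the
    -- tangent coordinates below.
    A₃ : ℚ
    A₃ = y₀ + y₀ + a₁ * x₀ + a₃

    periodic : ∀ {n} → n ⊙ P ≡ ∞ → ∀ k → (k ℕ.+ n) ⊙ P ≡ k ⊙ P
    periodic eq zero    = eq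
    periodic eq (suc k) = cong (P ⊕_) (periodic eq k)

    -- The slope is handed on through its linear equation alone, which keeps inverses out of the
    -- later polynomial identities.
    ⊕-chord : ∀ x y → x - x₀ ≢ 0ℚ →
      ∃[ m ] m * (x - x₀) ≡ y - y₀ × P ⊕ affine x y ≡ chord m x₀ y₀ x
    ⊕-chord x y x≢ with (x - x₀) ≟ 0ℚ
    ... | yes eq = contradiction eq x≢
    ... | no  ne = (y - y₀) * inv (x - x₀) ne
                 , eliminate (y - y₀) (*-inverse (x - x₀) ne)
                     (solve 3 (λ y x i → y :* i :* x := y :+ y :* (x :* i :- con (+ 1)))
                       refl (y - y₀) (x - x₀) (inv (x - x₀) ne))
                 , refl

    ⊕-opposite : ∀ x y → x - x₀ ≡ 0ℚ → y₀ + y + a₁ * x₀ + a₃ ≡ 0ℚ → P ⊕ affine x y ≡ ∞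
    ⊕-opposite x y ex ey with (x - x₀) ≟ 0ℚ
    ... | no  ne = contradiction ex ne
    ... | yes _ with (y₀ + y + a₁ * x₀ + a₃) ≟ 0ℚ
    ...   | no  ne = contradiction ey ne
    ...   | yes _  = refl

    ⊕≡∞⇒x≡x₀ : ∀ x y → P ⊕ affine x y ≡ ∞ → x - x₀ ≡ 0ℚ
    ⊕≡∞⇒x≡x₀ x y eq with (x - x₀) ≟ 0ℚ
    ... | yes e = e
    ⊕≡∞⇒x≡x₀ x y () | no _

    tangentNumerator : ℚ
    tangentNumerator = 3 · (x₀ * x₀) + 2 · (a₂ * x₀) + a₄ - a₁ * y₀

    ⊕-tangent : P ⊕ P ≢ ∞ →
      ∃[ m ] A₃ ≢ 0ℚ × m * A₃ ≡ tangentNumerator × P ⊕ P ≡ chord m x₀ y₀ x₀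
    ⊕-tangent 2P≢∞ with (x₀ - x₀) ≟ 0ℚ
    ... | no  ne = contradiction (ℚ.+-inverseʳ x₀) ne
    ... | yes _ with (y₀ + y₀ + a₁ * x₀ + a₃) ≟ 0ℚ
    ...   | yes _  = contradiction refl 2P≢∞
    ...   | no  ne = tangentNumerator * inv A₃ ne , ne
                 , eliminate tangentNumerator (*-inverse A₃ ne)
                     (solve 3 (λ T A i → T :* i :* A := T :+ T :* (A :* i :- con (+ 1)))
                       refl tangentNumerator A₃ (inv A₃ ne))
                 , refl

    -- Coordinates in which P is the origin and its tangent, of slope l, is Y = 0;
    -- the curve becomes Y² + A₁XY + A₃Y = X³ + A₂X².
    module Tangent (l : ℚ) where
      A₁ A₂ : ℚ
      A₁ = a₁ + ι (+ 2) * l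
      A₂ = a₂ - l * a₁ + ι (+ 3) * x₀ - l * l

      -- In tangent coordinates this is (X , - KX - A₃), the reflection of the point with abscissa X
      -- on the line of slope K - A₁ through the origin. Sums with `P` take this form.
      at : ℚ → ℚ → Point
      at X K = affine (X + x₀) (l * X - K * X - A₃ + y₀)

      chord≡at : ∀ m X → chord m x₀ y₀ (X + x₀) ≡ at ((m - l) * (m - l + A₁) - A₂ - X) (m - l + A₁)
      chord≡at m X = cong₂ affine
        (solve 6 (λ a₁ a₂ x₀ l m X →
          let A₁ = a₁ :+ con (+ 2) :* l
              A₂ = a₂ :- l :* a₁ :+ con (+ 3) :* x₀ :- l :* l in
          m :* m :+ a₁ :* m :- a₂ :- x₀ :- (X :+ x₀) :=
          (m :- l) :* (m :- l :+ A₁) :- A₂ :- X :+ x₀)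
          refl a₁ a₂ x₀ l m X)
        (solve 8 (λ a₁ a₂ a₃ x₀ y₀ l m X →
          let A₁ = a₁ :+ con (+ 2) :* l
              A₂ = a₂ :- l :* a₁ :+ con (+ 3) :* x₀ :- l :* l
              A₃ = y₀ :+ y₀ :+ a₁ :* x₀ :+ a₃
              x₃ = m :* m :+ a₁ :* m :- a₂ :- x₀ :- (X :+ x₀)
              X₃ = (m :- l) :* (m :- l :+ A₁) :- A₂ :- X in
          :- (m :* (x₃ :- x₀) :+ y₀) :- a₁ :* x₃ :- a₃ :=
          l :* X₃ :- (m :- l :+ A₁) :* X₃ :- A₃ :+ y₀)
          refl a₁ a₂ a₃ x₀ y₀ l m X)

      X≢0⇒x≢x₀ : ∀ {X} → X ≢ 0ℚ → X + x₀ - x₀ ≢ 0ℚ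
      X≢0⇒x≢x₀ {X} X≢0 eq = X≢0 (trans (solve 2 (λ X x₀ → X := X :+ x₀ :- x₀) refl X x₀) eq)

      -- `M` is the slope, in tangent coordinates, of the line through `P` and `at X K`, since the
      -- ordinate of the latter is - KX - A₃.
      ⊕-at : ∀ X K → X ≢ 0ℚ → ∃[ M ] X * M ≡ - (K * X) - A₃
        × P ⊕ at X K ≡ at (M * (M + A₁) - A₂ - X) (M + A₁)
      ⊕-at X K X≢0 =
        let m , eq , sum = ⊕-chord (X + x₀) (l * X - K * X - A₃ + y₀) (X≢0⇒x≢x₀ X≢0) in
          m - l
          , eliminate 1ℚ eq (solve 7 (λ X K A₃ l m x₀ y₀ →
              X :* (m :- l) := :- (K :* X) :- A₃
                :+ con (+ 1) :* (m :* (X :+ x₀ :- x₀) :- (l :* X :- K :* X :- A₃ :+ y₀ :- y₀)))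
              refl X K A₃ l m x₀ y₀)
          , trans sum (chord≡at m X)

      -- At abscissa 0 the point is (0 , - A₃), the negative of `P`, whatever `K` is.
      ⊕-at-0 : ∀ X K → X ≡ 0ℚ → P ⊕ at X K ≡ ∞
      ⊕-at-0 _ K refl = ⊕-opposite (0ℚ + x₀) (l * 0ℚ - K * 0ℚ - A₃ + y₀)
        (solve 1 (λ x₀ → con (+ 0) :+ x₀ :- x₀ := con (+ 0)) refl x₀)
        (solve 6 (λ a₁ a₃ x₀ y₀ l K → let A₃ = y₀ :+ y₀ :+ a₁ :* x₀ :+ a₃ in
          y₀ :+ (l :* con (+ 0) :- K :* con (+ 0) :- A₃ :+ y₀) :+ a₁ :* x₀ :+ a₃ := con (+ 0))
          refl a₁ a₃ x₀ y₀ l K)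

      P⊕at≡∞⇒X≡0 : ∀ X K → P ⊕ at X K ≡ ∞ → X ≡ 0ℚ
      P⊕at≡∞⇒X≡0 X K eq = trans (solve 2 (λ X x₀ → X := X :+ x₀ :- x₀) refl X x₀)
        (⊕≡∞⇒x≡x₀ (X + x₀) (l * X - K * X - A₃ + y₀) eq)

      -- For a point (X , XM) of the curve with X ≢ 0 the equation of the curve is
      -- XX′ = - A₃M, where X′ is the abscissa of its sum with P; so this says
      -- that the sum is again on the curve.
      next-collinear : ∀ X M M′ → X * (M * (M + A₁) - A₂ - X) ≡ - (A₃ * M) →
        let X′ = M * (M + A₁) - A₂ - X in
        X′ * M′ ≡ - ((M + A₁) * X′) - A₃ →
        X′ * (M′ * (M′ + A₁) - A₂ - X′) ≡ - (A₃ * M′)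
      next-collinear X M M′ e₂ e₁ = eliminate 1ℚ e₂ (eliminate (M′ - M) e₁
        (solve 6 (λ X M M′ A₁ A₂ A₃ → let X′ = M :* (M :+ A₁) :- A₂ :- X in
          X′ :* (M′ :* (M′ :+ A₁) :- A₂ :- X′) := :- (A₃ :* M′)
            :+ con (+ 1) :* (X :* X′ :- :- (A₃ :* M))
            :+ (M′ :- M) :* (X′ :* M′ :- (:- ((M :+ A₁) :* X′) :- A₃)))
          refl X M M′ A₁ A₂ A₃))

      tangent≡at : chord l x₀ y₀ x₀ ≡ at (- A₂) A₁
      tangent≡at = cong₂ affine
        (solve 4 (λ a₁ a₂ x₀ l →
          let A₂ = a₂ :- l :* a₁ :+ con (+ 3) :* x₀ :- l :* l in
          l :* l :+ a₁ :* l :- a₂ :- x₀ :- x₀ := :- A₂ :+ x₀)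
          refl a₁ a₂ x₀ l)
        (solve 6 (λ a₁ a₂ a₃ x₀ y₀ l →
          let A₁ = a₁ :+ con (+ 2) :* l
              A₂ = a₂ :- l :* a₁ :+ con (+ 3) :* x₀ :- l :* l
              A₃ = y₀ :+ y₀ :+ a₁ :* x₀ :+ a₃
              x₃ = l :* l :+ a₁ :* l :- a₂ :- x₀ :- x₀ in
          :- (l :* (x₃ :- x₀) :+ y₀) :- a₁ :* x₃ :- a₃ :=
          l :* (:- A₂) :- A₁ :* (:- A₂) :- A₃ :+ y₀)
          refl a₁ a₂ a₃ x₀ y₀ l)

      nonzero : ∀ n X K → n ⊙ P ≡ at X K → suc n ⊙ P ≢ ∞ → X ≢ 0ℚ
      nonzero n X K nP next≢∞ X≡0 = next≢∞ (trans (cong (P ⊕_) nP) (⊕-at-0 X K X≡0))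

      next : ∀ n X K → n ⊙ P ≡ at X K → suc n ⊙ P ≢ ∞ → ∃[ M ] X * M ≡ - (K * X) - A₃
        × suc n ⊙ P ≡ at (M * (M + A₁) - A₂ - X) (M + A₁)
      next n X K nP next≢∞ =
        let M , line , sum = ⊕-at X K (nonzero n X K nP next≢∞) in
        M , line , trans (cong (P ⊕_) nP) sum

      -- Abscissae of 2P, …, 6P, given the slopes Mₙ of the lines through P and nP.
      module Abscissae (M₂ M₃ M₄ M₅ : ℚ) where
        X₂ X₃ X₄ X₅ X₆ : ℚ
        X₂ = - A₂
        X₃ = M₂ * (M₂ + A₁) - A₂ - X₂
        X₄ = M₃ * (M₃ + A₁) - A₂ - X₃
        X₅ = M₄ * (M₄ + A₁) - A₂ - X₄
        X₆ = M₅ * (M₅ + A₁) - A₂ - X₅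

      -- Records the successive additions of `P` up to 6P. As 7P = ∞, the point 6P is the negative
      -- of `P`, which is why its abscissa vanishes.
      record Chain : Set where
        field M₂ M₃ M₄ M₅ : ℚ
        open Abscissae M₂ M₃ M₄ M₅ public
        field
          X₂≢0  : X₂ ≢ 0ℚ
          X₃≢0  : X₃ ≢ 0ℚ
          line₂ : X₂ * M₂ ≡ - (A₁ * X₂) - A₃
          line₃ : X₃ * M₃ ≡ - ((M₂ + A₁) * X₃) - A₃
          line₄ : X₄ * M₄ ≡ - ((M₃ + A₁) * X₄) - A₃
          line₅ : X₅ * M₅ ≡ - ((M₄ + A₁) * X₅) - A₃
          X₆≡0  : X₆ ≡ 0ℚ

      chain : (∀ (k : Fin 5) → (2 ℕ.+ toℕ k) ⊙ P ≢ ∞) → P ⊕ P ≡ chord l x₀ y₀ x₀ → 7 ⊙ P ≡ ∞ → Chain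
      chain nP≢∞ tangent 7P≡∞ =
        let 2P : 2 ⊙ P ≡ at (- A₂) A₁
            2P = trans tangent tangent≡at
            3P≢∞ = nP≢∞ (# 1)
            4P≢∞ = nP≢∞ (# 2)
            5P≢∞ = nP≢∞ (# 3)
            6P≢∞ = nP≢∞ (# 4)
            M₂ , line₂ , 3P = next 2 (- A₂) A₁ 2P 3P≢∞
            X₃ = M₂ * (M₂ + A₁) - A₂ - (- A₂)
            M₃ , line₃ , 4P = next 3 X₃ (M₂ + A₁) 3P 4P≢∞
            X₄ = M₃ * (M₃ + A₁) - A₂ - X₃
            M₄ , line₄ , 5P = next 4 X₄ (M₃ + A₁) 4P 5P≢∞
            X₅ = M₄ * (M₄ + A₁) - A₂ - X₄
            M₅ , line₅ , 6P = next 5 X₅ (M₄ + A₁) 5P 6P≢∞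
            X₆ = M₅ * (M₅ + A₁) - A₂ - X₅
        in record
          { M₂ = M₂ ; M₃ = M₃ ; M₄ = M₄ ; M₅ = M₅
          ; X₂≢0 = nonzero 2 (- A₂) A₁ 2P 3P≢∞ ; X₃≢0 = nonzero 3 X₃ (M₂ + A₁) 3P 4P≢∞
          ; line₂ = line₂ ; line₃ = line₃ ; line₄ = line₄ ; line₅ = line₅
          ; X₆≡0 = P⊕at≡∞⇒X≡0 X₆ (M₅ + A₁) (trans (cong (P ⊕_) (sym 6P)) 7P≡∞) }

      -- x = u²x′, y = u³y′ is the change to Tate's normal form, of parameter -w/u.
      record TateRelations : Set where
        field
          u v w : ℚ
          u≢0 : u ≢ 0ℚ
          A₁≡ : A₁ ≡ u - v
          A₂≡ : A₂ ≡ w * v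
          A₃≡ : A₃ ≡ u * (w * v)
          uv≡ : u * v ≡ w * (u + w)

      -- The condition `X₆≡0` is carried back along the chain: it forces 5P to have the abscissa of
      -- 2P, and the line through `P` and 4P to be the one through `P` and 2P. What remains is a
      -- relation among the slopes `M₂` and `M₃` and the coefficients.
      tate : A₃ ≢ 0ℚ → Chain → TateRelations
      tate A₃≢0 c = record
        { u = u ; v = M₂ ; w = w ; u≢0 = u≢0
        ; A₁≡ = solve 2 (λ M₂ A₁ → A₁ := M₂ :+ A₁ :- M₂) refl M₂ A₁
        ; A₂≡ = A₂≡wv
        ; A₃≡ = trans A₃≡uA₂ (cong (u *_) A₂≡wv)
        -- This equates the abscissae of 3P and 4P = -3P: the former is uv, and the definition of
        -- `X₄` reduces to w(u + w). Expanding `X₅≡-A₂` with `M₄≡M₂` gives the equality.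
        ; uv≡ = sym (eliminate 1ℚ A₂≡wv (eliminate (M₄ + M₂ + A₁) M₄≡M₂ (eliminate (- 1ℚ) X₅≡-A₂
           (solve 5 (λ M₂ M₃ M₄ A₁ A₂ →
              let u  = M₂ :+ A₁
                  w  = :- (M₃ :+ u)
                  X₃ = M₂ :* (M₂ :+ A₁) :- A₂ :- (:- A₂)
                  X₄ = M₃ :* (M₃ :+ A₁) :- A₂ :- X₃
                  X₅ = M₄ :* (M₄ :+ A₁) :- A₂ :- X₄ in
              w :* (u :+ w) := u :* M₂ :+ con (+ 1) :* (A₂ :- w :* M₂)
                :+ (M₄ :+ M₂ :+ A₁) :* (M₄ :- M₂) :+ (:- con (+ 1)) :* (X₅ :- (:- A₂)))
              refl M₂ M₃ M₄ A₁ A₂))))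
        }
        where
        open Chain c
        u w : ℚ
        u = M₂ + A₁
        w = - (M₃ + u)

        X₃≡M₂u : X₃ ≡ M₂ * u
        X₃≡M₂u = solve 3 (λ M₂ A₁ A₂ →
          M₂ :* (M₂ :+ A₁) :- A₂ :- (:- A₂) := M₂ :* (M₂ :+ A₁)) refl M₂ A₁ A₂

        u≢0 : u ≢ 0ℚ
        u≢0 = x*y≢0⇒y≢0 {M₂} (λ eq → X₃≢0 (trans X₃≡M₂u eq))

        A₃≡uA₂ : A₃ ≡ u * A₂
        A₃≡uA₂ = eliminate 1ℚ line₂ (solve 4 (λ M₂ A₁ A₂ A₃ →
          A₃ := (M₂ :+ A₁) :* A₂ :+ con (+ 1) :* (:- A₂ :* M₂ :- (:- (A₁ :* (:- A₂)) :- A₃)))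
          refl M₂ A₁ A₂ A₃)

        -- By `line₃`, w is A₃ / X₃; here X₃ is M₂u and A₃ is uA₂.
        A₂≡wv : A₂ ≡ w * M₂
        A₂≡wv = *-cancelˡ-≢0 u≢0 (eliminate 1ℚ line₃ (eliminate (- 1ℚ) A₃≡uA₂
          (solve 5 (λ M₂ M₃ A₁ A₂ A₃ →
            let u  = M₂ :+ A₁
                X₃ = M₂ :* (M₂ :+ A₁) :- A₂ :- (:- A₂) in
            u :* A₂ := u :* (:- (M₃ :+ u) :* M₂)
              :+ con (+ 1) :* (X₃ :* M₃ :- (:- (u :* X₃) :- A₃)) :+ (:- con (+ 1)) :* (A₃ :- u :* A₂))
            refl M₂ M₃ A₁ A₂ A₃)))

        -- The start of the induction whose step is `next-collinear`.
        collinear₂ : X₂ * X₃ ≡ - (A₃ * M₂)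
        collinear₂ = eliminate M₂ A₃≡uA₂ (solve 4 (λ M₂ A₁ A₂ A₃ →
          :- A₂ :* (M₂ :* (M₂ :+ A₁) :- A₂ :- (:- A₂)) :=
          :- (A₃ :* M₂) :+ M₂ :* (A₃ :- (M₂ :+ A₁) :* A₂))
          refl M₂ A₁ A₂ A₃)

        collinear₅ : X₅ * X₆ ≡ - (A₃ * M₅)
        collinear₅ = next-collinear X₄ M₄ M₅
          (next-collinear X₃ M₃ M₄ (next-collinear X₂ M₂ M₃ collinear₂ line₃) line₄) line₅

        -- Geometrically, 5P = -2P, so the line through `P` and 5P is the tangent at `P`, of slope 0
        -- in these coordinates.
        M₅≡0 : M₅ ≡ 0ℚ
        M₅≡0 = x*y≡0⇒y≡0 A₃≢0 (eliminate 1ℚ collinear₅ (eliminate (- X₅) X₆≡0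
          (solve 4 (λ X₅ X₆ A₃ M₅ → A₃ :* M₅ :=
              con (+ 0) :+ con (+ 1) :* (X₅ :* X₆ :- (:- (A₃ :* M₅))) :+ (:- X₅) :* (X₆ :- con (+ 0)))
            refl X₅ X₆ A₃ M₅)))

        X₅≡-A₂ : X₅ ≡ - A₂
        X₅≡-A₂ = eliminate (- 1ℚ) X₆≡0 (eliminate (M₅ + A₁) M₅≡0
          (solve 4 (λ X₅ M₅ A₁ A₂ → X₅ := :- A₂
              :+ (:- con (+ 1)) :* (M₅ :* (M₅ :+ A₁) :- A₂ :- X₅ :- con (+ 0))
              :+ (M₅ :+ A₁) :* (M₅ :- con (+ 0)))
            refl X₅ M₅ A₁ A₂))

        -- Geometrically, the line through `P` and 4P meets the curve again in -5P = 2P.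
        M₄≡M₂ : M₄ ≡ M₂
        M₄≡M₂ = *-cancelˡ-≢0 X₂≢0 (eliminate 1ℚ line₅ (eliminate (- X₅) M₅≡0
          (eliminate (- (M₄ + A₁)) X₅≡-A₂ (eliminate (- 1ℚ) A₃≡uA₂
          (solve 7 (λ X₅ M₂ M₄ M₅ A₁ A₂ A₃ → :- A₂ :* M₄ := :- A₂ :* M₂
            :+ con (+ 1) :* (X₅ :* M₅ :- (:- ((M₄ :+ A₁) :* X₅) :- A₃))
            :+ :- X₅ :* (M₅ :- con (+ 0))
            :+ :- (M₄ :+ A₁) :* (X₅ :- (:- A₂))
            :+ (:- con (+ 1)) :* (A₃ :- (M₂ :+ A₁) :* A₂))
            refl X₅ M₂ M₄ M₅ A₁ A₂ A₃)))))

  -- From Tate's relations to an integral model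

  module _ (W : Weierstrass ℚ) (x₀ y₀ : ℚ) where
    open Weierstrass W
    open GroupLaw ℚ-field W
    open Multiples W x₀ y₀
    open RawMonoidDefs (RawRing.+-rawMonoid (Field.rawRing ℚ-field)) using () renaming (_×_ to _·_)

    -- Passing to tangent coordinates and scaling by `u` gives Tate's form y² + (1 - c)xy - by = x³
    -- - bx² with c = d² - d and b = d³ - d². Scaling by the square of the denominator of `d` makes
    -- the coefficients integral.
    tate⇒≅ : ∀ l → OnCurve P → l * A₃ ≡ tangentNumerator → Tangent.TateRelations l →
      ∃[ d ] W ≅ mapW ι (tateModel (ℚ.↥ d) (ℚ.↧ d))
    tate⇒≅ l (affine-on on) tangent rel = d , record
      { u = U ; r = x₀ ; s = l ; t = y₀ ; u≢0 = U≢0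
      ; eq₁ = begin
          U * ι (n ℤ.* n ℤ.+ m ℤ.* n ℤ.- m ℤ.* m)
            ≡⟨ cong (U *_) (ι-evalℤ (Weierstrass.a₁ polynomials) (m ∷ n ∷ [])) ⟨
          U * (β * β + ι m * β - ι m * ι m)
            ≡⟨ cong (λ α → U * (β * β + α * β - α * α)) α≡dβ ⟩
          U * (β * β + d * β * β - d * β * (d * β))
            ≡⟨ solve 3 (λ U β d →
                 U :* (β :* β :+ d :* β :* β :- d :* β :* (d :* β)) :=
                 U :* β :* β :- U :* β :* β :* (d :* d :- d)) refl U β d ⟩
          U * β * β - U * β * β * (d * d - d)
            ≡⟨ cong₂ _-_ u≡ v≡ ⟨
          u - v
            ≡⟨ A₁≡ ⟨
          A₁
            ≡⟨ solve 2 (λ a₁ l → a₁ :+ con (+ 2) :* l := a₁ :+ 2 :× l) refl a₁ l ⟩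
          a₁ + 2 · l ∎
      ; eq₂ = begin
          U * U * ι (m ℤ.* m ℤ.* n ℤ.* (n ℤ.- m))
            ≡⟨ cong (U * U *_) ιa₂ ⟩
          U * U * (d * β * (d * β) * β * (β - d * β))
            ≡⟨ solve 3 (λ U β d →
                 U :* U :* (d :* β :* (d :* β) :* β :* (β :- d :* β)) :=
                 :- (d :* (U :* β :* β)) :* (U :* β :* β :* (d :* d :- d))) refl U β d ⟩
          - (d * (U * β * β)) * (U * β * β * (d * d - d))
            ≡⟨ cong₂ (λ u v → - (d * u) * v) u≡ v≡ ⟨
          - (d * u) * v
            ≡⟨ cong (_* v) w≡ ⟨
          w * v
            ≡⟨ A₂≡ ⟨
          A₂
            ≡⟨ solve 4 (λ a₁ a₂ x₀ l →
                 a₂ :- l :* a₁ :+ con (+ 3) :* x₀ :- l :* l :=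
                 a₂ :- l :* a₁ :+ 3 :× x₀ :- l :* l) refl a₁ a₂ x₀ l ⟩
          a₂ - l * a₁ + 3 · x₀ - l * l ∎
      ; eq₃ = begin
          U * U * U * ι (n ℤ.* n ℤ.* (m ℤ.* m ℤ.* n ℤ.* (n ℤ.- m)))
            ≡⟨ cong (U * U * U *_) (trans (ι-homo-* (n ℤ.* n) (m ℤ.* m ℤ.* n ℤ.* (n ℤ.- m)))
                                          (cong₂ _*_ (ι-homo-* n n) ιa₂)) ⟩
          U * U * U * (β * β * (d * β * (d * β) * β * (β - d * β)))
            ≡⟨ solve 3 (λ U β d →
                 U :* U :* U :* (β :* β :* (d :* β :* (d :* β) :* β :* (β :- d :* β))) :=
                 U :* β :* β :* (:- (d :* (U :* β :* β)) :* (U :* β :* β :* (d :* d :- d)))) refl U β d ⟩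
          U * β * β * (- (d * (U * β * β)) * (U * β * β * (d * d - d)))
            ≡⟨ cong₂ (λ u v → u * (- (d * u) * v)) u≡ v≡ ⟨
          u * (- (d * u) * v)
            ≡⟨ cong (λ w → u * (w * v)) w≡ ⟨
          u * (w * v)
            ≡⟨ A₃≡ ⟨
          A₃
            ≡⟨ solve 4 (λ a₁ a₃ x₀ y₀ →
                 y₀ :+ y₀ :+ a₁ :* x₀ :+ a₃ := a₃ :+ x₀ :* a₁ :+ 2 :× y₀) refl a₁ a₃ x₀ y₀ ⟩
          a₃ + x₀ * a₁ + 2 · y₀ ∎
      -- The coefficient a₄ of the Tate model is 0; the translated one vanishes because `l` is the
      -- slope of the tangent.
      ; eq₄ = eliminate 1ℚ tangent (solve 8 (λ U a₁ a₂ a₃ a₄ x₀ y₀ l →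
          U :* U :* U :* U :* con (+ 0) :=
          (a₄ :- l :* a₃ :+ 2 :× (x₀ :* a₂) :- (y₀ :+ x₀ :* l) :* a₁ :+ 3 :× (x₀ :* x₀) :- 2 :× (l :* y₀))
            :+ con (+ 1) :* (l :* (y₀ :+ y₀ :+ a₁ :* x₀ :+ a₃)
                             :- (3 :× (x₀ :* x₀) :+ 2 :× (a₂ :* x₀) :+ a₄ :- a₁ :* y₀)))
          refl U a₁ a₂ a₃ a₄ x₀ y₀ l)
      -- Likewise a₆ vanishes because the new origin lies on the curve.
      ; eq₆ = eliminate 1ℚ on (solve 8 (λ U a₁ a₂ a₃ a₄ a₆ x₀ y₀ →
          U :* U :* U :* U :* U :* U :* con (+ 0) :=
          (a₆ :+ x₀ :* a₄ :+ x₀ :* x₀ :* a₂ :+ x₀ :* x₀ :* x₀ :- y₀ :* a₃ :- y₀ :* y₀ :- x₀ :* y₀ :* a₁)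
            :+ con (+ 1) :* (y₀ :* y₀ :+ a₁ :* x₀ :* y₀ :+ a₃ :* y₀
                             :- (x₀ :* x₀ :* x₀ :+ a₂ :* x₀ :* x₀ :+ a₄ :* x₀ :+ a₆)))
          refl U a₁ a₂ a₃ a₄ a₆ x₀ y₀)
      }
      where
      open ≡-Reasoning
      open Tangent l
      open TateRelations rel
      d U β β⁻¹ : ℚ
      d = - (w * inv u u≢0)
      m n : ℤ
      m = ℚ.↥ d
      n = ℚ.↧ d
      β = ι n

      polynomials : Weierstrass (Polynomial 2)
      polynomials = ℚ-PolyTate.tateModel (var (# 0)) (var (# 1))

      β≢0 : β ≢ 0ℚ
      β≢0 eq = contradiction (ι-injective {n} {+ 0} eq) λ ()

      β⁻¹ = inv β β≢0
      -- Scaling by `u` leads to Tate's form with parameter `d`; `tateModel` is that form scaled by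
      -- β², which is divided out here.
      U = u * (β⁻¹ * β⁻¹)

      u≡ : u ≡ U * β * β
      u≡ = eliminate (- (u * (1ℚ + β * β⁻¹))) (*-inverse β β≢0)
        (solve 3 (λ u β i → u :=
          u :* (i :* i) :* β :* β :+ (:- (u :* (con (+ 1) :+ β :* i))) :* (β :* i :- con (+ 1)))
          refl u β β⁻¹)

      w≡ : w ≡ - (d * u)
      w≡ = eliminate (- w) (*-inverse u u≢0)
        (solve 3 (λ u i w → w := :- (:- (w :* i) :* u) :+ (:- w) :* (u :* i :- con (+ 1)))
          refl u (inv u u≢0) w)

      v≡ : v ≡ U * β * β * (d * d - d)
      v≡ = trans (*-cancelˡ-≢0 u≢0 (eliminate 1ℚ uv≡ (eliminate (u + w - d * u) w≡
        (solve 4 (λ u v w d → u :* v := u :* (u :* (d :* d :- d))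
            :+ con (+ 1) :* (u :* v :- w :* (u :+ w)) :+ (u :+ w :- d :* u) :* (w :- (:- (d :* u))))
          refl u v w d)))) (cong (_* (d * d - d)) u≡)

      α≡dβ : ι m ≡ d * β
      α≡dβ = sym (*-denominator d)

      ιa₂ : ι (m ℤ.* m ℤ.* n ℤ.* (n ℤ.- m)) ≡ d * β * (d * β) * β * (β - d * β)
      ιa₂ = trans (sym (ι-evalℤ (Weierstrass.a₂ polynomials) (m ∷ n ∷ [])))
        (cong (λ α → α * α * β * (β - α)) α≡dβ)

      U≢0 : U ≢ 0ℚ
      U≢0 eq = u≢0 (trans u≡ (trans (cong (λ U → U * β * β) eq)
        (solve 1 (λ β → con (+ 0) :* β :* β := con (+ 0)) refl β)))

  7-torsion⇒tate : ∀ E → HasNontrivialTorsion 7 E →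
    ∃[ d ] IsIntegralModel E (tateModel (ℚ.↥ d) (ℚ.↧ d))
  7-torsion⇒tate E (GroupLaw.∞ , _ , P≢∞) = contradiction refl P≢∞
  7-torsion⇒tate E (GroupLaw.affine x₀ y₀ , (on , 7P≡∞) , P≢∞) =
    let l , A₃≢0 , tangent , double = ⊕-tangent (nP≢∞ (# 0)) in
    tate⇒≅ W x₀ y₀ l on tangent (Tangent.tate l A₃≢0 (Tangent.chain l nP≢∞ double 7P≡∞))
    where
    open EllipticCurve E renaming (equation to W)
    open GroupLaw ℚ-field W
    open Multiples W x₀ y₀

    -- Since 7P = ∞, the order of P cannot be one of 2, …, 6: nP = ∞ gives
    -- (7 mod n)P = ∞.
    2P≢∞ : 2 ⊙ P ≢ ∞
    2P≢∞ eq = P≢∞ (trans (sym (periodic {2} eq 1))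
      (trans (sym (periodic {2} eq 3)) (trans (sym (periodic {2} eq 5)) 7P≡∞)))

    3P≢∞ : 3 ⊙ P ≢ ∞
    3P≢∞ eq = P≢∞ (trans (sym (periodic {3} eq 1)) (trans (sym (periodic {3} eq 4)) 7P≡∞))

    nP≢∞ : ∀ (k : Fin 5) → (2 ℕ.+ toℕ k) ⊙ P ≢ ∞
    nP≢∞ zero                         eq = 2P≢∞ eq
    nP≢∞ (suc zero)                   eq = 3P≢∞ eq
    nP≢∞ (suc (suc zero))             eq = 3P≢∞ (trans (sym (periodic {4} eq 3)) 7P≡∞)
    nP≢∞ (suc (suc (suc zero)))       eq = 2P≢∞ (trans (sym (periodic {5} eq 2)) 7P≡∞)
    nP≢∞ (suc (suc (suc (suc zero)))) eq = P≢∞ (trans (sym (periodic {6} eq 1)) 7P≡∞)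

open SevenTorsion using (7-torsion⇒tate)

-- Divisibility by primes

module PrimeDivisibility where
  open ℤᵈ using (_∣_; divides; ∣⇒∣ᵤ; ∣ᵤ⇒∣)
  open ℤ-Solver

  euclid : ∀ {p} → Prime p → ∀ x y → + p ∣ x ℤ.* y → + p ∣ x ⊎ + p ∣ y
  euclid {p} pr x y d = Sum.map (∣ᵤ⇒∣ {+ p} {x}) (∣ᵤ⇒∣ {+ p} {y})
    (euclidsLemma ℤ.∣ x ∣ ℤ.∣ y ∣ pr (subst (p ℕᵈ.∣_) (ℤ.abs-* x y) (∣⇒∣ᵤ d)))

  prime∤1 : ∀ {p} → Prime p → ¬ + p ∣ + 1
  prime∤1 pr d with ℕᵈ.∣1⇒≡1 (∣⇒∣ᵤ d)
  ... | refl = ¬prime[1] pr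

  prime∣^⇒∣ : ∀ {p} → Prime p → ∀ x k → + p ∣ x ℤ.^ k → + p ∣ x
  prime∣^⇒∣ pr x zero    d = contradiction d (prime∤1 pr)
  prime∣^⇒∣ pr x (suc k) d = [ id , prime∣^⇒∣ pr x k ]′ (euclid pr x (x ℤ.^ k) d)

  cancel-∤ : ∀ {p} → Prime p → ∀ k {m n} → ¬ p ℕᵈ.∣ m → p ℕ.^ k ℕᵈ.∣ m ℕ.* n → p ℕ.^ k ℕᵈ.∣ n
  cancel-∤ pr zero    p∤m d = ℕᵈ.1∣ _
  cancel-∤ {p} pr (suc k) {m} {n} p∤m d with euclidsLemma m n pr (ℕᵈ.∣-trans (ℕᵈ.m∣m*n (p ℕ.^ k)) d)
  ... | inj₁ p∣m = contradiction p∣m p∤m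
  ... | inj₂ (ℕᵈ.divides q refl) = subst (p ℕ.* p ℕ.^ k ℕᵈ.∣_) (ℕ.*-comm p q)
    (ℕᵈ.*-monoʳ-∣ p (cancel-∤ pr k p∤m (ℕᵈ.*-cancelˡ-∣ p
      (subst (p ℕ.* p ℕ.^ k ℕᵈ.∣_) (trans (sym (ℕ.*-assoc m q p)) (ℕ.*-comm (m ℕ.* q) p)) d))))
    where instance _ = prime⇒nonZero pr

  cancel-∤ℤ : ∀ {p} → Prime p → ∀ k x y → ¬ + p ∣ x → + (p ℕ.^ k) ∣ x ℤ.* y → + (p ℕ.^ k) ∣ y
  cancel-∤ℤ {p} pr k x y p∤x d = ∣ᵤ⇒∣ {+ (p ℕ.^ k)} {y}
    (cancel-∤ pr k (p∤x ∘ ∣ᵤ⇒∣ {+ p} {x}) (subst (p ℕ.^ k ℕᵈ.∣_) (ℤ.abs-* x y) (∣⇒∣ᵤ d)))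

  ∣⇒^∣^ : ∀ {p x} → + p ∣ x → ∀ k → + (p ℕ.^ k) ∣ x ℤ.^ k
  ∣⇒^∣^ d zero    = divides (+ 1) refl
  ∣⇒^∣^ {p} {x} d@(divides q refl) (suc k) with ∣⇒^∣^ d k
  ... | divides r eq = divides (q ℤ.* r) (begin
    x ℤ.* x ℤ.^ k                       ≡⟨ cong (x ℤ.*_) eq ⟩
    q ℤ.* + p ℤ.* (r ℤ.* + (p ℕ.^ k))   ≡⟨ solve 4 (λ q p r s → q :* p :* (r :* s) := q :* r :* (p :* s))
                                              refl q (+ p) r (+ (p ℕ.^ k)) ⟩
    q ℤ.* r ℤ.* (+ p ℤ.* + (p ℕ.^ k))   ≡⟨ cong (q ℤ.* r ℤ.*_) (sym (ℤ.pos-* p (p ℕ.^ k))) ⟩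
    q ℤ.* r ℤ.* + (p ℕ.* p ℕ.^ k)       ∎)
    where
    open ≡-Reasoning

  -- Zero is ruled out by its divisor 2; any other number has the first entry of its factorisation
  -- as a prime divisor, unless there is none.
  no-prime-divisor⇒≡1 : ∀ n → (∀ r → Prime r → ¬ r ℕᵈ.∣ n) → n ≡ 1
  no-prime-divisor⇒≡1 zero      none = contradiction (2 ℕᵈ.∣0) (none 2 prime[2])
  no-prime-divisor⇒≡1 n@(suc _) none with factorise n
  ... | record { factors = []     ; isFactorisation = eq } = eq
  ... | record { factors = r ∷ rs ; isFactorisation = eq ; factorsPrime = pr ∷ _ } =
    contradiction (subst (r ℕᵈ.∣_) (sym eq) (ℕᵈ.m∣m*n _)) (none r pr)

  no-prime-divisor⇒unit : ∀ x → (∀ r → Prime r → ¬ + r ∣ x) → ℤ.∣ x ∣ ≡ 1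
  no-prime-divisor⇒unit x none = no-prime-divisor⇒≡1 ℤ.∣ x ∣ (λ r pr → none r pr ∘ ∣ᵤ⇒∣ {+ r} {x})

  odd⇒1+even : ∀ x → ¬ + 2 ∣ x → ∃[ k ] x ≡ + 1 ℤ.+ k ℤ.* + 2
  odd⇒1+even x 2∤x with x %ℕ 2 | n%ℕd<d x 2 | a≡a%ℕn+[a/ℕn]*n x 2
  ... | 0 | _ | eq = contradiction (divides (x /ℕ 2) (trans eq (ℤ.+-identityˡ _))) 2∤x
  ... | 1 | _ | eq = x /ℕ 2 , eq
  ... | suc (suc _) | s≤s (s≤s ()) | _

  odd-odd : ∀ x y → ¬ + 2 ∣ x → ¬ + 2 ∣ y → + 2 ∣ x ℤ.- y
  odd-odd x y 2∤x 2∤y with odd⇒1+even x 2∤x | odd⇒1+even y 2∤y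
  ... | k , refl | l , refl = divides (k ℤ.- l) (solve 2 (λ k l →
    con (+ 1) :+ k :* con (+ 2) :- (con (+ 1) :+ l :* con (+ 2)) := (k :- l) :* con (+ 2)) refl k l)

  prime-^∤ : ∀ {p} → Prime p → ∀ {x} k → ¬ + p ∣ x → ¬ + p ∣ x ℤ.^ k
  prime-^∤ pr {x} k p∤x = p∤x ∘ prime∣^⇒∣ pr x k

open PrimeDivisibility

-- Arithmetic of the Tate models

module TateArithmetic where
  open import Data.Integer.Base using (_+_; _-_; -_; _*_; _^_; ≢-nonZero)
  open ℤᵈ using
    ( _∣_; divides; ∣⇒∣ᵤ; ∣ᵤ⇒∣; _∣?_; ∣-trans; ∣m∣n⇒∣m+n; ∣m∣n⇒∣m-n; ∣m+n∣m⇒∣n; ∣m+n∣n⇒∣m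
    ; ∣m⇒∣m*n; ∣n⇒∣m*n; ∣m⇒∣-m )
  open ℤ-Invariants using (Δ; c₄)
  open ℤ-Solver

  cubicForm : ℤ → ℤ → ℤ
  cubicForm a b = a * a * a - + 8 * (a * a * b) + + 5 * (a * b * b) + b * b * b

  :cubicForm : ∀ {n} (a b : Polynomial n) → Polynomial n
  :cubicForm a b =
    a :* a :* a :- con (+ 8) :* (a :* a :* b) :+ con (+ 5) :* (a :* b :* b) :+ b :* b :* b

  -- The cofactor of B²E³ in the discriminant of y² + Axy + BEy = x³ + Ex².
  cofactor : ℤ → ℤ → ℤ → ℤ
  cofactor A B E = - ((A * A + + 4 * E) * (A * A + + 4 * E)) - + 8 * (A * A * A * B)
    - + 27 * (B * B * E) + + 9 * ((A * A + + 4 * E) * A * B)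

  :cofactor : ∀ {n} (A B E : Polynomial n) → Polynomial n
  :cofactor A B E =
    :- ((A :* A :+ con (+ 4) :* E) :* (A :* A :+ con (+ 4) :* E)) :- con (+ 8) :* (A :* A :* A :* B)
    :- con (+ 27) :* (B :* B :* E) :+ con (+ 9) :* ((A :* A :+ con (+ 4) :* E) :* A :* B)

  Δ-tateModel : ∀ a b → Δ (tateModel a b) ≡ (a * b * (a - b)) ^ 7 * cubicForm a b
  Δ-tateModel a b = begin
    Δ (tateModel a b)
      -- The expansion goes in stages, first with `A`, `B`, `E` as unknowns, to keep the degrees
      -- low. Then E = - ac and the cofactor - ae⁴f turn the product into c³(abe)⁴f, where c = abe.
      ≡⟨ solve 3 (λ A B E →
           ℤ-Poly.Δ (weierstrass A E (B :* E) (con (+ 0)) (con (+ 0))) :=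
           B :* B :* (E :* E :* E) :* :cofactor A B E) refl A B E ⟩
    B * B * (E * E * E) * cofactor A B E
      ≡⟨ cong₂ (λ E F → B * B * (E * E * E) * F)
           (solve 2 (λ a b → a :* a :* b :* (b :- a) := :- (a :* (a :* b :* (a :- b)))) refl a b)
           (solve 2 (λ a b →
             :cofactor (b :* b :+ a :* b :- a :* a) (b :* b) (a :* a :* b :* (b :- a)) :=
             :- (a :* ((a :- b) :* (a :- b) :* (a :- b) :* (a :- b)) :* :cubicForm a b)) refl a b) ⟩
    B * B * (- (a * c) * - (a * c) * - (a * c)) * - (a * (e * e * e * e) * f)
      ≡⟨ solve 5 (λ q c h f a →
           q :* (:- (a :* c) :* :- (a :* c) :* :- (a :* c)) :* :- (a :* h :* f) :=
           c :* (c :* (c :* (q :* (a :* a :* a :* a) :* h))) :* f)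
           refl (b * b * (b * b)) c (e * e * e * e) f a ⟩
    c * (c * (c * (b * b * (b * b) * (a * a * a * a) * (e * e * e * e)))) * f
      ≡⟨ cong (λ c⁴ → c * (c * (c * c⁴)) * f) (solve 3 (λ a b e →
           b :* b :* (b :* b) :* (a :* a :* a :* a) :* (e :* e :* e :* e) :=
           (a :* b :* e) :^ 4) refl a b e) ⟩
    c ^ 7 * f ∎
    where
    open ≡-Reasoning
    A B E e c f : ℤ
    A = b * b + a * b - a * a
    B = b * b
    E = a * a * b * (b - a)
    e = a - b
    c = a * b * e
    f = cubicForm a b

  -- Isolates A⁴ modulo `E`, for the primes that divide `E`.
  c₄-tateModel : ∀ a b → let A = b * b + a * b - a * a ; E = a * a * b * (b - a) in
    c₄ (tateModel a b) ≡ A * A * (A * A) + E * (+ 8 * (A * A) + + 16 * E - + 24 * (A * (b * b)))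
  c₄-tateModel a b = solve 3 (λ A B E →
    ℤ-Poly.c₄ (weierstrass A E (B :* E) (con (+ 0)) (con (+ 0))) :=
    A :* A :* (A :* A) :+ E :* (con (+ 8) :* (A :* A) :+ con (+ 16) :* E :- con (+ 24) :* (A :* B)))
    refl (b * b + a * b - a * a) (b * b) (a * a * b * (b - a))

  -- Up to the factor b⁶, the remainder of c₄ modulo the cubic form.  A Bézout
  -- identity between this remainder and the cubic form, which have resultant
  -- ±49, is remainder-cubicForm.
  remainder : ℤ → ℤ → ℤ
  remainder a b = + 2065 * (a * a) - + 1454 * (a * b) - + 283 * (b * b)

  :remainder : ∀ {n} (a b : Polynomial n) → Polynomial n
  :remainder a b = con (+ 2065) :* (a :* a) :- con (+ 1454) :* (a :* b) :- con (+ 283) :* (b :* b)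

  c₄≡remainder : ∀ a b → ∃[ q ] c₄ (tateModel a b) ≡ b ^ 6 * remainder a b + cubicForm a b * q
  c₄≡remainder a b =
      -- The quotient on dividing `c₄` by the cubic form, which is monic in `a`, written in Horner
      -- form.
      + 284 * b ^ 5 + a * (+ 38 * b ^ 4 + a * (+ 3 * b ^ 3 + a * (+ 5 * b ^ 2 + a * (a - + 4 * b))))
    , trans (c₄-tateModel a b) (solve 2 (λ a b →
        let A = b :* b :+ a :* b :- a :* a
            E = a :* a :* b :* (b :- a) in
        A :* A :* (A :* A)
          :+ E :* (con (+ 8) :* (A :* A) :+ con (+ 16) :* E :- con (+ 24) :* (A :* (b :* b))) :=
        b :^ 6 :* :remainder a b
          :+ :cubicForm a b :* (con (+ 284) :* b :^ 5 :+ a :* (con (+ 38) :* b :^ 4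
             :+ a :* (con (+ 3) :* b :^ 3 :+ a :* (con (+ 5) :* b :^ 2 :+ a :* (a :- con (+ 4) :* b))))))
        refl a b)

  remainder-cubicForm : ∀ a b →
    remainder a b * (+ 1710 * (b * b) + + 3005 * (a * b) - + 444 * (a * a)) ≡
    + 49 * b ^ 4 + (- + 483979 * b - + 916860 * a) * cubicForm a b
  remainder-cubicForm = solve 2 (λ a b →
    :remainder a b :* (con (+ 1710) :* (b :* b) :+ con (+ 3005) :* (a :* b) :- con (+ 444) :* (a :* a)) :=
    con (+ 49) :* b :^ 4 :+ (:- con (+ 483979) :* b :- con (+ 916860) :* a) :* :cubicForm a b) refl

  discriminant : ℤ → ℤ → ℤ
  discriminant a b = (a * b * (a - b)) ^ 7 * cubicForm a b

  -- Unit values of the cubic form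

  ∀∣x∣≤? : ∀ {P : ℤ → Set} → (∀ x → Dec (P x)) → ∀ n → Dec (∀ x → ℤ.∣ x ∣ ℕ.≤ n → P x)
  ∀∣x∣≤? {P} P? n with ℕ.allUpTo? (λ k → P? (+ k) ×-dec P? (- + k)) (suc n)
  ... | no ¬all = no λ all → ¬all λ {k} k<1+n → all (+ k) (ℕ.≤-pred k<1+n)
      , all (- + k) (subst (ℕ._≤ n) (sym (ℤ.∣-i∣≡∣i∣ (+ k))) (ℕ.≤-pred k<1+n))
  ... | yes all = yes λ { (+ k) k≤n → proj₁ (all (s≤s k≤n)) ; -[1+ k ] k<n → proj₂ (all (s≤s k<n)) }

  -- A finite search. Roots are bounded by 8 below; when a - b is a unit, `a` may exceed the bound
  -- on `b` by 1, whence 9.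
  small-cubicForm : ∀ a → ℤ.∣ a ∣ ℕ.≤ 9 → ∀ b → ℤ.∣ b ∣ ℕ.≤ 9 →
    ℤ.∣ cubicForm a b ∣ ≡ 1 → a * b * (a - b) ≡ + 0
  small-cubicForm = from-yes (∀∣x∣≤? (λ a → ∀∣x∣≤? (λ b →
    (ℤ.∣ cubicForm a b ∣ ℕ.≟ 1) →-dec (a * b * (a - b) ℤ.≟ + 0)) 9) 9)

  -- If x (x² + sx + t) = k then x divides k, or, when k = 0, it divides t.
  root-bound : ∀ x s t k → x ≢ + 0 → x * (x * x + s * x + t) ≡ k → t ≢ + 0 →
    ℤ.∣ k ∣ ℕ.≤ 8 → ℤ.∣ t ∣ ℕ.≤ 8 → ℤ.∣ x ∣ ℕ.≤ 8
  root-bound x s t k x≢0 eq t≢0 k≤8 t≤8 with k ℤ.≟ + 0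
  ... | no k≢0 = ℕ.≤-trans (ℕᵈ.∣⇒≤ {{≢-nonZero k≢0}} (∣⇒∣ᵤ {x} {k} x∣k)) k≤8
    where
    x∣k : x ∣ k
    x∣k = divides (x * x + s * x + t) (trans (sym eq) (ℤ.*-comm x (x * x + s * x + t)))
  ... | yes refl with ℤ.i*j≡0⇒i≡0∨j≡0 x eq
  ...   | inj₁ x≡0 = contradiction x≡0 x≢0
  ...   | inj₂ eq′ = ℕ.≤-trans (ℕᵈ.∣⇒≤ {{≢-nonZero t≢0}} (∣⇒∣ᵤ {x} {t} x∣t)) t≤8
    where
    open ≡-Reasoning
    x∣t : x ∣ t
    x∣t = divides (- (x + s)) (begin
      t                                      ≡⟨ solve 3 (λ x s t →
                                                  t := (x :* x :+ s :* x :+ t) :+ :- (x :+ s) :* x)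
                                                  refl x s t ⟩
      x * x + s * x + t + - (x + s) * x      ≡⟨ cong (_+ - (x + s) * x) eq′ ⟩
      + 0 + - (x + s) * x                    ≡⟨ ℤ.+-identityˡ (- (x + s) * x) ⟩
      - (x + s) * x                          ∎)

  unit-square : ∀ x → ℤ.∣ x ∣ ≡ 1 → x * x ≡ + 1
  unit-square (+ 1)    refl = refl
  unit-square -[1+ 0 ] refl = refl

  unit-cube : ∀ x → ℤ.∣ x ∣ ≡ 1 → ℤ.∣ x * x * x ∣ ≡ 1
  unit-cube (+ 1)    refl = refl
  unit-cube -[1+ 0 ] refl = refl

  -- Serves the equation "cubic form = unit" with one variable `y` a unit: its pure cube, also a
  -- unit, is moved to the right, and `root-bound` applies to what is left.
  small-root : ∀ x y m n k l → x ≢ + 0 → n ≢ + 0 → ℤ.∣ n ∣ ℕ.≤ 8 →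
    ℤ.∣ y ∣ ≡ 1 → ℤ.∣ k ∣ ≡ 1 → ℤ.∣ l ∣ ≡ 1 →
    x * (x * x + m * y * x + n * (y * y)) ≡ k - l → ℤ.∣ x ∣ ℕ.≤ 8
  small-root x y m n k l x≢0 n≢0 n≤8 ∣y∣≡1 ∣k∣≡1 ∣l∣≡1 eq =
    root-bound x (m * y) n (k - l) x≢0
      (trans (cong (λ z → x * (x * x + m * y * x + z)) (sym ny²≡n)) eq) n≢0 ∣k-l∣≤8 n≤8
    where
    ny²≡n : n * (y * y) ≡ n
    ny²≡n = trans (cong (n *_) (unit-square y ∣y∣≡1)) (ℤ.*-identityʳ n)
    ∣k-l∣≤8 : ℤ.∣ k - l ∣ ℕ.≤ 8
    ∣k-l∣≤8 = ℕ.≤-trans (ℤ.∣i-j∣≤∣i∣+∣j∣ k l)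
      (subst (ℕ._≤ 8) (sym (cong₂ ℕ._+_ ∣k∣≡1 ∣l∣≡1)) (s≤s (s≤s z≤n)))

  module _ (a b : ℤ) (abc≢0 : a * b * (a - b) ≢ + 0) where
    a≢0 : a ≢ + 0
    a≢0 refl = abc≢0 refl

    b≢0 : b ≢ + 0
    b≢0 refl = abc≢0 (trans (cong (_* (a - + 0)) (ℤ.*-zeroʳ a)) refl)

    cubicForm≢unit : ℤ.∣ a ∣ ≡ 1 ⊎ ℤ.∣ b ∣ ≡ 1 ⊎ ℤ.∣ a - b ∣ ≡ 1 → ℤ.∣ cubicForm a b ∣ ≢ 1
    cubicForm≢unit (inj₁ ∣a∣≡1) ∣f∣≡1 =
      abc≢0 (small-cubicForm a (subst (ℕ._≤ 9) (sym ∣a∣≡1) (s≤s z≤n)) b (ℕ.m≤n⇒m≤1+n b≤8) ∣f∣≡1)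
      where
      b≤8 : ℤ.∣ b ∣ ℕ.≤ 8
      b≤8 = small-root b a (+ 5) (- + 8) (cubicForm a b) (a * a * a)
        b≢0 (λ ()) ℕ.≤-refl ∣a∣≡1 ∣f∣≡1 (unit-cube a ∣a∣≡1)
        (solve 2 (λ a b →
          b :* (b :* b :+ con (+ 5) :* a :* b :+ :- con (+ 8) :* (a :* a)) :=
          :cubicForm a b :- a :* a :* a) refl a b)
    cubicForm≢unit (inj₂ (inj₁ ∣b∣≡1)) ∣f∣≡1 =
      abc≢0 (small-cubicForm a (ℕ.m≤n⇒m≤1+n a≤8) b (subst (ℕ._≤ 9) (sym ∣b∣≡1) (s≤s z≤n)) ∣f∣≡1)
      where
      a≤8 : ℤ.∣ a ∣ ℕ.≤ 8
      a≤8 = small-root a b (- + 8) (+ 5) (cubicForm a b) (b * b * b)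
        a≢0 (λ ()) (from-yes (5 ℕ.≤? 8)) ∣b∣≡1 ∣f∣≡1 (unit-cube b ∣b∣≡1)
        (solve 2 (λ a b →
          a :* (a :* a :+ :- con (+ 8) :* b :* a :+ con (+ 5) :* (b :* b)) :=
          :cubicForm a b :- b :* b :* b) refl a b)
    cubicForm≢unit (inj₂ (inj₂ ∣c∣≡1)) ∣f∣≡1 =
      abc≢0 (small-cubicForm a a≤9 b (ℕ.m≤n⇒m≤1+n b≤8) ∣f∣≡1)
      where
      c : ℤ
      c = a - b
      -- In terms of b and c the cubic form is c³ - b(b² + 8cb + 5c²).
      b≤8 : ℤ.∣ b ∣ ℕ.≤ 8
      b≤8 = small-root b c (+ 8) (+ 5) (c * c * c) (cubicForm a b)
        b≢0 (λ ()) (from-yes (5 ℕ.≤? 8)) ∣c∣≡1 (unit-cube c ∣c∣≡1) ∣f∣≡1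
        (solve 2 (λ a b → let c = a :- b in
          b :* (b :* b :+ con (+ 8) :* c :* b :+ con (+ 5) :* (c :* c)) :=
          c :* c :* c :- :cubicForm a b) refl a b)
      a≤9 : ℤ.∣ a ∣ ℕ.≤ 9
      a≤9 = subst (λ x → ℤ.∣ x ∣ ℕ.≤ 9) (solve 2 (λ a b → b :+ (a :- b) := a) refl a b)
        (ℕ.≤-trans (ℤ.∣i+j∣≤∣i∣+∣j∣ b c) (ℕ.+-mono-≤ b≤8 (ℕ.≤-reflexive ∣c∣≡1)))

  -- Two units among a, b, a - b

  TwoUnits : ℤ → ℤ → Set
  TwoUnits a b =
    (ℤ.∣ a ∣ ≡ 1 × ℤ.∣ b ∣ ≡ 1) ⊎ (ℤ.∣ a ∣ ≡ 1 × ℤ.∣ a - b ∣ ≡ 1) ⊎ (ℤ.∣ b ∣ ≡ 1 × ℤ.∣ a - b ∣ ≡ 1)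

  twoUnits? : ∀ a b → Dec (TwoUnits a b)
  twoUnits? a b = (ℤ.∣ a ∣ ℕ.≟ 1 ×-dec ℤ.∣ b ∣ ℕ.≟ 1)
    ⊎-dec (ℤ.∣ a ∣ ℕ.≟ 1 ×-dec ℤ.∣ a - b ∣ ℕ.≟ 1)
    ⊎-dec (ℤ.∣ b ∣ ℕ.≟ 1 ×-dec ℤ.∣ a - b ∣ ℕ.≟ 1)

  -- The remaining one of a, b, a - b is a sum or difference of two units, so searching up to 2 is
  -- enough.
  small-twoUnits : ∀ a → ℤ.∣ a ∣ ℕ.≤ 2 → ∀ b → ℤ.∣ b ∣ ℕ.≤ 2 →
    a * b * (a - b) ≢ + 0 → TwoUnits a b → discriminant a b ≡ - + 1664
  small-twoUnits = from-yes (∀∣x∣≤? (λ a → ∀∣x∣≤? (λ b →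
    ¬? (a * b * (a - b) ℤ.≟ + 0) →-dec (twoUnits? a b →-dec (discriminant a b ℤ.≟ - + 1664))) 2) 2)

  twoUnits⇒discriminant : ∀ a b →
    a * b * (a - b) ≢ + 0 → TwoUnits a b → discriminant a b ≡ - + 1664
  twoUnits⇒discriminant a b abc≢0 units = small-twoUnits a (a≤2 units) b (b≤2 units) abc≢0 units
    where
    1≤2 : ∀ {n} → n ≡ 1 → n ℕ.≤ 2
    1≤2 refl = s≤s z≤n

    a≤2 : TwoUnits a b → ℤ.∣ a ∣ ℕ.≤ 2
    a≤2 (inj₁ (∣a∣≡1 , _))            = 1≤2 ∣a∣≡1
    a≤2 (inj₂ (inj₁ (∣a∣≡1 , _)))     = 1≤2 ∣a∣≡1
    a≤2 (inj₂ (inj₂ (∣b∣≡1 , ∣c∣≡1))) =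
      subst (λ x → ℤ.∣ x ∣ ℕ.≤ 2) (solve 2 (λ a b → b :+ (a :- b) := a) refl a b)
        (ℕ.≤-trans (ℤ.∣i+j∣≤∣i∣+∣j∣ b (a - b)) (ℕ.≤-reflexive (cong₂ ℕ._+_ ∣b∣≡1 ∣c∣≡1)))

    b≤2 : TwoUnits a b → ℤ.∣ b ∣ ℕ.≤ 2
    b≤2 (inj₁ (_ , ∣b∣≡1))            = 1≤2 ∣b∣≡1
    b≤2 (inj₂ (inj₁ (∣a∣≡1 , ∣c∣≡1))) =
      subst (λ x → ℤ.∣ x ∣ ℕ.≤ 2) (solve 2 (λ a b → a :- (a :- b) := b) refl a b)
        (ℕ.≤-trans (ℤ.∣i-j∣≤∣i∣+∣j∣ a (a - b)) (ℕ.≤-reflexive (cong₂ ℕ._+_ ∣a∣≡1 ∣c∣≡1)))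
    b≤2 (inj₂ (inj₂ (∣b∣≡1 , _)))     = 1≤2 ∣b∣≡1

  -- Prime divisors of a, b, a - b and of the cubic form

  module CoprimePair (a b : ℤ) (coprime : ∀ {r} → Prime r → + r ∣ a → + r ∣ b → ⊥) where
    c f : ℤ
    c = a - b
    f = cubicForm a b

    a⊥c : ∀ {r} → Prime r → + r ∣ a → + r ∣ c → ⊥
    a⊥c {r} pr r∣a r∣c = coprime pr r∣a
      (subst (+ r ∣_) (solve 2 (λ a b → a :- (a :- b) := b) refl a b) (∣m∣n⇒∣m-n r∣a r∣c))

    b⊥c : ∀ {r} → Prime r → + r ∣ b → + r ∣ c → ⊥
    b⊥c {r} pr r∣b r∣c = coprime pr
      (subst (+ r ∣_) (solve 2 (λ a b → a :- b :+ b := a) refl a b) (∣m∣n⇒∣m+n r∣c r∣b)) r∣b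

    -- Modulo `a` the cubic form is b³; in the next two lemmas it is a³ modulo `b` and - a³ modulo
    -- `c`.
    f⊥a : ∀ {r} → Prime r → + r ∣ f → + r ∣ a → ⊥
    f⊥a {r} pr r∣f r∣a = coprime pr r∣a (prime∣^⇒∣ pr b 3 (∣m+n∣m⇒∣n
      (subst (+ r ∣_) (solve 2 (λ a b → :cubicForm a b :=
          a :* (a :* a :- con (+ 8) :* (a :* b) :+ con (+ 5) :* (b :* b)) :+ b :^ 3) refl a b) r∣f)
      (∣m⇒∣m*n (a * a - + 8 * (a * b) + + 5 * (b * b)) r∣a)))

    f⊥b : ∀ {r} → Prime r → + r ∣ f → + r ∣ b → ⊥
    f⊥b {r} pr r∣f r∣b = coprime pr (prime∣^⇒∣ pr a 3 (∣m+n∣m⇒∣n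
      (subst (+ r ∣_) (solve 2 (λ a b → :cubicForm a b :=
          b :* (b :* b :- con (+ 8) :* (a :* a) :+ con (+ 5) :* (a :* b)) :+ a :^ 3) refl a b) r∣f)
      (∣m⇒∣m*n (b * b - + 8 * (a * a) + + 5 * (a * b)) r∣b))) r∣b

    f⊥c : ∀ {r} → Prime r → + r ∣ f → + r ∣ c → ⊥
    f⊥c {r} pr r∣f r∣c = a⊥c pr (prime∣^⇒∣ pr a 3 (subst (+ r ∣_)
      (solve 2 (λ a b → let c = a :- b in
        :- (:cubicForm a b :- c :* (con (+ 2) :* (a :* a) :- con (+ 6) :* (a :* b) :- b :* b)) := a :^ 3)
        refl a b)
      (∣m⇒∣-m (∣m∣n⇒∣m-n r∣f (∣m⇒∣m*n (+ 2 * (a * a) - + 6 * (a * b) - b * b) r∣c))))) r∣c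

    2∣abc : + 2 ∣ a ⊎ + 2 ∣ b ⊎ + 2 ∣ c
    2∣abc with + 2 ∣? a | + 2 ∣? b
    ... | yes 2∣a | _       = inj₁ 2∣a
    ... | no  _   | yes 2∣b = inj₂ (inj₁ 2∣b)
    ... | no  2∤a | no  2∤b = inj₂ (inj₂ (odd-odd a b 2∤a 2∤b))

    2∤f : ¬ + 2 ∣ f
    2∤f 2∣f = [ f⊥a prime[2] 2∣f , [ f⊥b prime[2] 2∣f , f⊥c prime[2] 2∣f ]′ ]′ 2∣abc

    ∣a⇒∣Δ : ∀ {r} → + r ∣ a → + r ∣ discriminant a b
    ∣a⇒∣Δ r∣a = ∣m⇒∣m*n f (∣m⇒∣m*n ((a * b * c) ^ 6) (∣m⇒∣m*n c (∣m⇒∣m*n b r∣a)))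

    ∣b⇒∣Δ : ∀ {r} → + r ∣ b → + r ∣ discriminant a b
    ∣b⇒∣Δ r∣b = ∣m⇒∣m*n f (∣m⇒∣m*n ((a * b * c) ^ 6) (∣m⇒∣m*n c (∣n⇒∣m*n a r∣b)))

    ∣c⇒∣Δ : ∀ {r} → + r ∣ c → + r ∣ discriminant a b
    ∣c⇒∣Δ r∣c = ∣m⇒∣m*n f (∣m⇒∣m*n ((a * b * c) ^ 6) (∣n⇒∣m*n (a * b) r∣c))

    ∣f⇒∣Δ : ∀ {r} → + r ∣ f → + r ∣ discriminant a b
    ∣f⇒∣Δ r∣f = ∣n⇒∣m*n ((a * b * c) ^ 7) r∣f

    ∣Δ⇒ : ∀ {r} → Prime r → + r ∣ discriminant a b → (+ r ∣ a ⊎ + r ∣ b ⊎ + r ∣ c) ⊎ + r ∣ f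
    ∣Δ⇒ pr r∣Δ = Sum.map₁
      (λ r∣abc⁷ → [ Sum.map₂ inj₁ ∘ euclid pr a b , inj₂ ∘ inj₂ ]′
        (euclid pr (a * b) c (prime∣^⇒∣ pr (a * b * c) 7 r∣abc⁷)))
      (euclid pr ((a * b * c) ^ 7) f r∣Δ)

    module TwoPrimes (abc≢0 : a * b * c ≢ + 0) {p q : ℕ} (prime-p : Prime p) (prime-q : Prime q)
                     (only : ∀ {r} → Prime r → + r ∣ discriminant a b → r ≡ p ⊎ r ≡ q) where

      unit : ∀ x → (∀ {r} → + r ∣ x → + r ∣ discriminant a b) → ¬ + p ∣ x → ¬ + q ∣ x → ℤ.∣ x ∣ ≡ 1
      unit x x⇒Δ p∤x q∤x = no-prime-divisor⇒unit x λ r pr r∣x →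
        [ (λ { refl → p∤x r∣x }) , (λ { refl → q∤x r∣x }) ]′ (only pr (x⇒Δ r∣x))

      p∣f⊎q∣f : + p ∣ f ⊎ + q ∣ f
      p∣f⊎q∣f with + p ∣? f | + q ∣? f
      ... | yes p∣f | _       = inj₁ p∣f
      ... | no  _   | yes q∣f = inj₂ q∣f
      ... | no  p∤f | no  q∤f =
        contradiction (unit f ∣f⇒∣Δ p∤f q∤f) (cubicForm≢unit a b abc≢0 some-unit)
        where
        -- Each of p and q divides at most one of a, b, c.
        some-unit : ℤ.∣ a ∣ ≡ 1 ⊎ ℤ.∣ b ∣ ≡ 1 ⊎ ℤ.∣ a - b ∣ ≡ 1
        some-unit with + p ∣? a | + q ∣? a | + p ∣? b | + q ∣? b
        ... | no p∤a  | no q∤a  | _       | _       = inj₁ (unit a ∣a⇒∣Δ p∤a q∤a)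
        ... | _       | _       | no p∤b  | no q∤b  = inj₂ (inj₁ (unit b ∣b⇒∣Δ p∤b q∤b))
        ... | yes p∣a | _       | yes p∣b | _       = ⊥-elim (coprime prime-p p∣a p∣b)
        ... | _       | yes q∣a | _       | yes q∣b = ⊥-elim (coprime prime-q q∣a q∣b)
        ... | yes p∣a | _       | _       | yes q∣b =
          inj₂ (inj₂ (unit c ∣c⇒∣Δ (a⊥c prime-p p∣a) (b⊥c prime-q q∣b)))
        ... | _       | yes q∣a | yes p∣b | _       =
          inj₂ (inj₂ (unit c ∣c⇒∣Δ (b⊥c prime-p p∣b) (a⊥c prime-q q∣a)))

      -- As 2 divides abc it is `p` or `q`, and it is not `q` because `f` is odd. Only one of a, b,
      -- c is even, and `q` divides none of them.
      two-units : + q ∣ f → TwoUnits a b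
      two-units q∣f with only prime[2] ([ ∣a⇒∣Δ , [ ∣b⇒∣Δ , ∣c⇒∣Δ ]′ ]′ 2∣abc)
      ... | inj₂ refl = contradiction q∣f 2∤f
      ... | inj₁ refl with 2∣abc
      ...   | inj₁ 2∣a = inj₂ (inj₂
        ( unit b ∣b⇒∣Δ (coprime prime[2] 2∣a) (f⊥b prime-q q∣f)
        , unit c ∣c⇒∣Δ (a⊥c prime[2] 2∣a) (f⊥c prime-q q∣f)))
      ...   | inj₂ (inj₁ 2∣b) = inj₂ (inj₁
        ( unit a ∣a⇒∣Δ (λ 2∣a → coprime prime[2] 2∣a 2∣b) (f⊥a prime-q q∣f)
        , unit c ∣c⇒∣Δ (b⊥c prime[2] 2∣b) (f⊥c prime-q q∣f)))
      ...   | inj₂ (inj₂ 2∣c) = inj₁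
        ( unit a ∣a⇒∣Δ (λ 2∣a → a⊥c prime[2] 2∣a 2∣c) (f⊥a prime-q q∣f)
        , unit b ∣b⇒∣Δ (λ 2∣b → b⊥c prime[2] 2∣b 2∣c) (f⊥b prime-q q∣f))

    discriminant≡-1664 : a * b * c ≢ + 0 → ∀ {p q} → Prime p → Prime q →
      (∀ {r} → Prime r → + r ∣ discriminant a b → r ≡ p ⊎ r ≡ q) → discriminant a b ≡ - + 1664
    discriminant≡-1664 abc≢0 prime-p prime-q only = twoUnits⇒discriminant a b abc≢0
      ([ TwoPrimes.two-units abc≢0 prime-q prime-p (λ pr r∣Δ → Sum.swap (only pr r∣Δ))
       , TwoPrimes.two-units abc≢0 prime-p prime-q only ]′
        (TwoPrimes.p∣f⊎q∣f abc≢0 prime-p prime-q only))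

  -- Comparison of integral models at a prime

  module _ {W W′ : Weierstrass ℤ} (C : Comparison W W′) {p : ℕ} (pr : Prime p) where
    open Comparison C

    p∣m⇒p∤n : + p ∣ m → ¬ + p ∣ + n
    p∣m⇒p∤n p∣m p∣n = ¬prime[1] (subst Prime (coprime (∣⇒∣ᵤ p∣m , ∣⇒∣ᵤ p∣n)) pr)

    -- By coprimality `p` does not divide `n`, so in `Δ-ratio` the factor p¹² of m¹² has to come
    -- from `Δ W′`.
    p∣m⇒p¹²∣Δ : + p ∣ m → + (p ℕ.^ 12) ∣ Δ W′
    p∣m⇒p¹²∣Δ p∣m = cancel-∤ℤ pr 12 ((+ n) ^ 12) (Δ W′) (prime-^∤ pr {+ n} 12 (p∣m⇒p∤n p∣m))
      (subst (+ (p ℕ.^ 12) ∣_) Δ-ratio (∣m⇒∣m*n (Δ W) (∣⇒^∣^ p∣m 12)))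

    p∣m⇒p⁴∣c₄ : + p ∣ m → + (p ℕ.^ 4) ∣ c₄ W′
    p∣m⇒p⁴∣c₄ p∣m = cancel-∤ℤ pr 4 ((+ n) ^ 4) (c₄ W′) (prime-^∤ pr {+ n} 4 (p∣m⇒p∤n p∣m))
      (subst (+ (p ℕ.^ 4) ∣_) c₄-ratio (∣m⇒∣m*n (c₄ W) (∣⇒^∣^ p∣m 4)))

    p∣n⇒p¹²∣Δ : + p ∣ + n → + (p ℕ.^ 12) ∣ Δ W
    p∣n⇒p¹²∣Δ p∣n = cancel-∤ℤ pr 12 (m ^ 12) (Δ W) (prime-^∤ pr {m} 12 λ p∣m → p∣m⇒p∤n p∣m p∣n)
      (subst (+ (p ℕ.^ 12) ∣_) (sym Δ-ratio) (∣m⇒∣m*n (Δ W′) (∣⇒^∣^ p∣n 12)))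

    p∤m⇒Δ-∣ : ¬ + p ∣ m → ∀ k → + (p ℕ.^ k) ∣ Δ W′ → + (p ℕ.^ k) ∣ Δ W
    p∤m⇒Δ-∣ p∤m k d = cancel-∤ℤ pr k (m ^ 12) (Δ W) (prime-^∤ pr {m} 12 p∤m)
      (subst (+ (p ℕ.^ k) ∣_) (sym Δ-ratio) (∣n⇒∣m*n ((+ n) ^ 12) d))

    p∣Δ′×p∤Δ⇒p∣m : + p ∣ Δ W′ → ¬ + p ∣ Δ W → + p ∣ m
    p∣Δ′×p∤Δ⇒p∣m p∣Δ′ p∤Δ = prime∣^⇒∣ pr m 12 ([ id , (λ p∣Δ → contradiction p∣Δ p∤Δ) ]′
      (euclid pr (m ^ 12) (Δ W) (subst (+ p ∣_) (sym Δ-ratio) (∣n⇒∣m*n ((+ n) ^ 12) p∣Δ′))))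

  p¹²∤1664 : ∀ {p} → Prime p → ¬ + (p ℕ.^ 12) ∣ - + 1664
  p¹²∤1664 {p} pr d = ℕ.<⇒≱ (from-yes (1664 ℕ.<? 4096)) (begin
    4096      ≤⟨ ℕ.^-monoˡ-≤ 12 (ℕ.nonTrivial⇒n>1 p {{prime⇒nonTrivial pr}}) ⟩
    p ℕ.^ 12  ≤⟨ ℕᵈ.∣⇒≤ (∣⇒∣ᵤ {+ (p ℕ.^ 12)} { - + 1664} d) ⟩
    1664      ∎)
    where open ℕ.≤-Reasoning

  -- A model with a smaller order of `Δ` at p would need p to divide `m`, and then p¹² would divide
  -- 1664, which is below 2¹².
  minimal-discriminant-1664 : ∀ E W →
    IsIntegralModel E W → Δ W ≡ - + 1664 → IsGlobalMinimalModel E W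
  minimal-discriminant-1664 E W i ΔW p pr = i , λ W′ i′ k d →
    let C = compare E W′ W i′ i
        p∤m p∣m = p¹²∤1664 pr (subst (+ (p ℕ.^ 12) ∣_) ΔW (p∣m⇒p¹²∣Δ C pr p∣m))
    in ∣⇒∣ᵤ (p∤m⇒Δ-∣ C pr p∤m k (∣ᵤ⇒∣ {+ (p ℕ.^ k)} {Δ W} d))

  -- The ratio m / n of the scaling factors is a unit: a prime dividing `m` or `n` would have its
  -- 12th power divide 1664.
  unique-discriminant-1664 : ∀ E W W′ →
    IsIntegralModel E W → Δ W ≡ - + 1664 → IsGlobalMinimalModel E W′ → Δ W′ ≡ - + 1664
  unique-discriminant-1664 E W W′ i ΔW min = begin
    Δ W′             ≡⟨ ℤ.*-identityˡ (Δ W′) ⟨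
    + 1 * Δ W′       ≡⟨ cong (_* Δ W′) (unit-^12 m ∣m∣≡1) ⟨
    m ^ 12 * Δ W′    ≡⟨ Δ-ratio ⟩
    (+ n) ^ 12 * Δ W ≡⟨ cong (λ n → (+ n) ^ 12 * Δ W) n≡1 ⟩
    + 1 * Δ W        ≡⟨ ℤ.*-identityˡ (Δ W) ⟩
    Δ W              ≡⟨ ΔW ⟩
    - + 1664         ∎
    where
    open ≡-Reasoning
    -- Minimality at any prime includes integrality; 2 is an arbitrary choice.
    C = compare E W′ W (proj₁ (min 2 prime[2])) i
    open Comparison C

    p¹²∤ΔW : ∀ {p} → Prime p → ¬ + (p ℕ.^ 12) ∣ Δ W
    p¹²∤ΔW pr = p¹²∤1664 pr ∘ subst (_ ∣_) ΔW

    unit-^12 : ∀ x → ℤ.∣ x ∣ ≡ 1 → x ^ 12 ≡ + 1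
    unit-^12 (+ 1)    refl = refl
    unit-^12 -[1+ 0 ] refl = refl

    ∣m∣≡1 : ℤ.∣ m ∣ ≡ 1
    ∣m∣≡1 = no-prime-divisor⇒unit m λ r pr r∣m → p¹²∤ΔW pr (p∣m⇒p¹²∣Δ C pr r∣m)

    n≡1 : n ≡ 1
    -- A prime r dividing `n` makes r¹² divide `Δ W′`, and the minimality of `W′` passes this on to
    -- `Δ W`.
    n≡1 = no-prime-divisor⇒unit (+ n) λ r pr r∣n → p¹²∤ΔW pr
      (∣ᵤ⇒∣ {+ (r ℕ.^ 12)} {Δ W} (proj₂ (min r pr) W i 12 (∣⇒∣ᵤ (p∣n⇒p¹²∣Δ C pr r∣n))))

  p⁴∤49 : ∀ {p} → Prime p → ¬ + (p ℕ.^ 4) ∣ + 49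
  p⁴∤49 {p} pr d with prime⇒irreducible prime[7] p∣7
    where
    prime[7] : Prime 7
    prime[7] = from-yes (prime? 7)
    p∣7 : p ℕᵈ.∣ 7
    p∣7 = [ id , id ]′ (euclidsLemma 7 7 pr (ℕᵈ.∣-trans (ℕᵈ.m∣m*n (p ℕ.^ 3)) (∣⇒∣ᵤ d)))
  ... | inj₁ refl = ¬prime[1] pr
  ... | inj₂ refl = from-no (2401 ℕᵈ.∣? 49) (∣⇒∣ᵤ d)

  -- Minimality of the Tate model

  module TateReduction (a b : ℤ) (coprime : ∀ {r} → Prime r → + r ∣ a → + r ∣ b → ⊥) where
    open CoprimePair a b coprime

    T : Weierstrass ℤ
    T = tateModel a b

    A E : ℤ
    A = b * b + a * b - a * a
    E = a * a * b * (b - a)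

    -- `A` is b² modulo `a` and modulo `c`, and - a² modulo `b`.
    p∤A : ∀ {p} → Prime p → + p ∣ a ⊎ + p ∣ b ⊎ + p ∣ c → ¬ + p ∣ A
    p∤A {p} pr p∣abc p∣A = [ case-a , [ case-b , case-c ]′ ]′ p∣abc
      where
      case-a : ¬ + p ∣ a
      case-a p∣a = coprime pr p∣a (prime∣^⇒∣ pr b 2 (∣m+n∣n⇒∣m
        (subst (+ p ∣_) (solve 2 (λ a b →
          b :* b :+ a :* b :- a :* a := b :^ 2 :+ a :* (b :- a)) refl a b) p∣A)
        (∣m⇒∣m*n (b - a) p∣a)))
      case-b : ¬ + p ∣ b
      case-b p∣b = coprime pr (prime∣^⇒∣ pr a 2 (subst (+ p ∣_)
        (solve 2 (λ a b → b :* (b :+ a) :- (b :* b :+ a :* b :- a :* a) := a :^ 2) refl a b)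
        (∣m∣n⇒∣m-n (∣m⇒∣m*n (b + a) p∣b) p∣A))) p∣b
      case-c : ¬ + p ∣ c
      case-c p∣c = b⊥c pr (prime∣^⇒∣ pr b 2 (subst (+ p ∣_)
        (solve 2 (λ a b → b :* b :+ a :* b :- a :* a :+ (a :- b) :* a := b :^ 2) refl a b)
        (∣m∣n⇒∣m+n p∣A (∣m⇒∣m*n a p∣c)))) p∣c

    p∣abc⇒p∣E : ∀ {p} → + p ∣ a ⊎ + p ∣ b ⊎ + p ∣ c → + p ∣ E
    p∣abc⇒p∣E (inj₁ p∣a)        = ∣m⇒∣m*n (b - a) (∣m⇒∣m*n b (∣m⇒∣m*n a p∣a))
    p∣abc⇒p∣E (inj₂ (inj₁ p∣b)) = ∣m⇒∣m*n (b - a) (∣n⇒∣m*n (a * a) p∣b)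
    p∣abc⇒p∣E {p} (inj₂ (inj₂ p∣c)) = ∣n⇒∣m*n (a * a * b)
      (subst (+ p ∣_) (solve 2 (λ a b → :- (a :- b) := b :- a) refl a b) (∣m⇒∣-m p∣c))

    p∣abc⇒p∤c₄ : ∀ {p} → Prime p → + p ∣ a ⊎ + p ∣ b ⊎ + p ∣ c → ¬ + p ∣ c₄ T
    p∣abc⇒p∤c₄ {p} pr p∣abc p∣c₄ = p∤A pr p∣abc ([ p∣A² , p∣A² ]′ (euclid pr (A * A) (A * A)
      (∣m+n∣n⇒∣m (subst (+ p ∣_) (c₄-tateModel a b) p∣c₄)
        (∣m⇒∣m*n (+ 8 * (A * A) + + 16 * E - + 24 * (A * (b * b))) (p∣abc⇒p∣E p∣abc)))))
      where
      p∣A² : + p ∣ A * A → + p ∣ A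
      p∣A² d = [ id , id ]′ (euclid pr A A d)

    -- As p does not divide `b`, powers of `b` cancel: p⁴ divides b⁶ times the remainder, hence the
    -- remainder, hence 49b⁴, hence 49.
    p∣f⇒¬p⁴∣f×p⁴∣c₄ : ∀ {p} → Prime p → + p ∣ f → + (p ℕ.^ 4) ∣ f → + (p ℕ.^ 4) ∣ c₄ T → ⊥
    p∣f⇒¬p⁴∣f×p⁴∣c₄ {p} pr p∣f p⁴∣f p⁴∣c₄ = p⁴∤49 pr (cancel-∤ℤ pr 4 (b ^ 4) (+ 49) (p∤bᵏ 4)
      (subst (+ (p ℕ.^ 4) ∣_) (ℤ.*-comm (+ 49) (b ^ 4))
        (∣m+n∣n⇒∣m (subst (+ (p ℕ.^ 4) ∣_) (remainder-cubicForm a b)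
          (∣m⇒∣m*n (+ 1710 * (b * b) + + 3005 * (a * b) - + 444 * (a * a)) p⁴∣remainder))
          (∣n⇒∣m*n (- + 483979 * b - + 916860 * a) p⁴∣f))))
      where
      p∤bᵏ : ∀ k → ¬ + p ∣ b ^ k
      p∤bᵏ k = prime-^∤ pr {b} k (f⊥b pr p∣f)
      p⁴∣remainder : + (p ℕ.^ 4) ∣ remainder a b
      p⁴∣remainder = let q , eq = c₄≡remainder a b in
        cancel-∤ℤ pr 4 (b ^ 6) (remainder a b) (p∤bᵏ 6)
          (∣m+n∣n⇒∣m (subst (+ (p ℕ.^ 4) ∣_) eq p⁴∣c₄) (∣m⇒∣m*n q p⁴∣f))

    -- Refutes what a smaller discriminant order at p in another integral model would entail for `Δ`
    -- and `c₄`.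
    tate-minimal : ∀ {p} → Prime p →
      + p ∣ Δ T → + (p ℕ.^ 12) ∣ Δ T → + (p ℕ.^ 4) ∣ c₄ T → ⊥
    tate-minimal {p} pr p∣Δ p¹²∣Δ p⁴∣c₄ =
      [ (λ p∣abc → p∣abc⇒p∤c₄ pr p∣abc (∣-trans p∣p⁴ p⁴∣c₄))
      , (λ p∣f → p∣f⇒¬p⁴∣f×p⁴∣c₄ pr p∣f (p⁴∣f p∣f) p⁴∣c₄)
      ]′ (∣Δ⇒ pr (subst (+ p ∣_) (Δ-tateModel a b) p∣Δ))
      where
      p∣p⁴ : + p ∣ + (p ℕ.^ 4)
      p∣p⁴ = ∣ᵤ⇒∣ (ℕᵈ.m∣m*n (p ℕ.^ 3))
      p∤abc : + p ∣ f → ¬ + p ∣ a * b * c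
      p∤abc p∣f d = [ (λ p∣ab → [ f⊥a pr p∣f , f⊥b pr p∣f ]′ (euclid pr a b p∣ab)) , f⊥c pr p∣f ]′
        (euclid pr (a * b) c d)
      -- Since p does not divide abc, all of p¹² falls on `f`; p⁴ is what the Bézout argument takes.
      p⁴∣f : + p ∣ f → + (p ℕ.^ 4) ∣ f
      p⁴∣f p∣f = ∣-trans (∣ᵤ⇒∣ (ℕᵈ.divides (p ℕ.^ 8) (ℕ.^-distribˡ-+-* p 8 4)))
        (cancel-∤ℤ pr 12 ((a * b * c) ^ 7) f (prime-^∤ pr {a * b * c} 7 (p∤abc p∣f))
          (subst (+ (p ℕ.^ 12) ∣_) (Δ-tateModel a b) p¹²∣Δ))

open TateArithmetic

-- Conductors

open import Data.Integer.Base using (-_; ∣_∣)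
open import Data.Nat.Base using (_*_; _^_; _<_; _≤_)
open ℕᵈ using (_∣_; divides; m∣m*n; ∣-trans; ∣⇒≤; _∣0)
open ℤᵈ using (∣⇒∣ᵤ; ∣ᵤ⇒∣; _∣?_) renaming (_∣_ to _∣ℤ_; divides to dividesℤ)
open ℤ-Invariants using (Δ)

prime∣^⇒∣ℕ : ∀ {p} → Prime p → ∀ n k → p ∣ n ^ k → p ∣ n
prime∣^⇒∣ℕ pr n zero    d = contradiction (∣ᵤ⇒∣ d) (prime∤1 pr)
prime∣^⇒∣ℕ pr n (suc k) d = [ id , prime∣^⇒∣ℕ pr n k ]′ (euclidsLemma n (n ^ k) pr d)

prime∣prime⇒≡ : ∀ {p q} → Prime p → Prime q → p ∣ q → p ≡ q
prime∣prime⇒≡ pr-p pr-q p∣q with prime⇒irreducible pr-q p∣q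
... | inj₁ refl = contradiction pr-p ¬prime[1]
... | inj₂ p≡q  = p≡q

prime[13] : Prime 13
prime[13] = from-yes (prime? 13)

2∣n×13∣n⇒26∣n : ∀ {n} → 2 ∣ n → 13 ∣ n → 26 ∣ n
2∣n×13∣n⇒26∣n 2∣n (divides q refl) with euclidsLemma q 13 prime[2] 2∣n
... | inj₁ (divides s refl) = divides s (ℕ.*-assoc s 2 13)
... | inj₂ 2∣13             = contradiction (prime∣prime⇒≡ prime[2] prime[13] 2∣13) λ ()

module Conductor (E : EllipticCurve ℚ-field) (N : ℕ) (conductor : IsConductor E N) where

  N≢0 : N ≢ 0
  N≢0 refl with conductor 2 prime[2]
  ... | f , _ , _ , ¬∣0 = ¬∣0 (_ ∣0)

  -- A conductor exponent brings its own minimal model, hence the quantifier over `W`. Only `good`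
  -- has exponent 0, and there the hypothesis is contradicted.
  bad⇒∣N : ∀ {p} → Prime p → (∀ W → IsMinimalModelAt E p W → + p ∣ℤ Δ W) → p ∣ N
  bad⇒∣N {p} pr bad with conductor p pr
  ... | _ , good W min p∤Δ , _             = contradiction (∣⇒∣ᵤ (bad W min)) p∤Δ
  ... | _ , multiplicative _ _ _ _ , d , _ = subst (_∣ N) (ℕ.*-identityʳ p) d
  ... | _ , additive _ δ _ _ _ _ , d , _   = ∣-trans (m∣m*n (p ^ suc δ)) d

-- Discriminant and conductor of a curve with a Tate model

module SevenTorsionCurve (E : EllipticCurve ℚ-field) (d : ℚ)
                         (i : IsIntegralModel E (tateModel (ℚ.↥ d) (ℚ.↧ d))) where
  a b : ℤ
  a = ℚ.↥ d
  b = ℚ.↧ d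

  coprime : ∀ {r} → Prime r → + r ∣ℤ a → + r ∣ℤ b → ⊥
  coprime pr r∣a r∣b = ¬prime[1] (subst Prime (coprime-↥-↧ₙ d (∣⇒∣ᵤ r∣a , ∣⇒∣ᵤ r∣b)) pr)

  open TateReduction a b coprime hiding (E)

  abc≢0 : a ℤ.* b ℤ.* (a ℤ.- b) ≢ + 0
  abc≢0 abc≡0 = EllipticCurve.nonsingular E (begin
    ℚ-Invariants.Δ (EllipticCurve.equation E)   ≡⟨ Δ-≅ i ⟨
    u¹² ℚ.* ℚ-Invariants.Δ (mapW ι T)           ≡⟨ cong (u¹² ℚ.*_) (Δ-mapW-ι T) ⟩
    u¹² ℚ.* ι (Δ T)                             ≡⟨ cong (λ x → u¹² ℚ.* ι x) Δ≡0 ⟩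
    u¹² ℚ.* ℚ.0ℚ                                ≡⟨ ℚ.*-zeroʳ u¹² ⟩
    ℚ.0ℚ                                        ∎)
    where
    open ≡-Reasoning
    u¹² = _≅_.u i ^ℚ 12
    Δ≡0 : Δ T ≡ + 0
    Δ≡0 = trans (Δ-tateModel a b) (cong (λ x → x ℤ.^ 7 ℤ.* cubicForm a b) abc≡0)

  module _ (N : ℕ) (conductor : IsConductor E N) (two : IsTwoPrimeProduct N) where
    open Conductor E N conductor

    -- If some minimal model at p had `Δ` prime to p, its comparison with `T` would have p dividing
    -- `m`, contrary to `tate-minimal`.
    ∣Δ⇒∣N : ∀ {p} → Prime p → + p ∣ℤ Δ T → p ∣ N
    ∣Δ⇒∣N {p} pr p∣Δ = bad⇒∣N pr λ W min → decidable-stable (+ p ∣? Δ W) λ p∤Δ →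
      let C = compare E W T (proj₁ min) i
          p∣m = p∣Δ′×p∤Δ⇒p∣m C pr p∣Δ p∤Δ
      in tate-minimal pr p∣Δ (p∣m⇒p¹²∣Δ C pr p∣m) (p∣m⇒p⁴∣c₄ C pr p∣m)

    prime-divisors : ∀ {p q α β} → Prime p → Prime q → N ≡ p ^ α * q ^ β →
      ∀ {r} → Prime r → + r ∣ℤ discriminant a b → r ≡ p ⊎ r ≡ q
    prime-divisors {p} {q} {α} {β} prime-p prime-q N≡ {r} pr r∣Δ =
      Sum.map (prime∣prime⇒≡ pr prime-p ∘ prime∣^⇒∣ℕ pr p α) (prime∣prime⇒≡ pr prime-q ∘ prime∣^⇒∣ℕ pr q β)
        (euclidsLemma (p ^ α) (q ^ β) pr (subst (r ∣_) N≡ r∣N))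
      where
      r∣N : r ∣ N
      r∣N = ∣Δ⇒∣N pr (subst (+ r ∣ℤ_) (sym (Δ-tateModel a b)) r∣Δ)

    Δ≡-1664 : Δ T ≡ - + 1664
    Δ≡-1664 = let _ , _ , α , β , prime-p , prime-q , _ , _ , _ , N≡ = two in
      trans (Δ-tateModel a b) (CoprimePair.discriminant≡-1664 a b coprime abc≢0 prime-p prime-q
        (prime-divisors {α = α} {β = β} prime-p prime-q N≡))

    -- Both primes of 1664 = 2⁷·13 divide `N`, so N ≥ 26, and 26³ = 17576.
    1664<N³ : 1664 < N ^ 3
    1664<N³ = ℕ.<-≤-trans (from-yes (1664 ℕ.<? 26 ^ 3))
      (ℕ.^-monoˡ-≤ 3 (∣⇒≤ {{ℕ.≢-nonZero N≢0}} (2∣n×13∣n⇒26∣n 2∣N 13∣N)))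
      where
      2∣N : 2 ∣ N
      2∣N = ∣Δ⇒∣N prime[2] (subst (+ 2 ∣ℤ_) (sym Δ≡-1664) (dividesℤ (- + 832) refl))
      13∣N : 13 ∣ N
      13∣N = ∣Δ⇒∣N prime[13] (subst (+ 13 ∣ℤ_) (sym Δ≡-1664) (dividesℤ (- + 128) refl))

theorem3p6 : ((E : EllipticCurve ℚ-field) (N : ℕ) →
    HasNontrivialTorsion 7 E → IsConductor E N → IsTwoPrimeProduct N →
    IsMinimalDiscriminant E (- (+ (2 ^ 7 * 13))) ×
    ((Δ : ℤ) → IsMinimalDiscriminant E Δ →
    Δ ≡ - (+ (2 ^ 7 * 13)) × ∣ Δ ∣ < N ^ 3))
    ×
    ((ε : ℝ) → Positive ε →
    ∃[ C ] ((E : EllipticCurve ℚ-field) (N : ℕ) (Δ : ℤ) →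
    HasNontrivialTorsion 7 E → IsConductor E N → IsTwoPrimeProduct N →
    IsMinimalDiscriminant E Δ →
    PowerBound ∣ Δ ∣ C N 6 ε))
-- The constant is 1664 for every ε: it equals the absolute value of each minimal discriminant, and
-- the power of the nonzero `N` is at least 1.
theorem3p6 = determined , λ ε ε>0 → 1664 , λ E N Δ torsion conductor two min r _ →
  subst (λ x → x ^ ℚ.↧ₙ r ≤ 1664 ^ ℚ.↧ₙ r * N ^ (6 * ℚ.↧ₙ r ℕ.+ ∣ ℚ.↥ r ∣))
    (cong ∣_∣ (sym (proj₁ (proj₂ (determined E N torsion conductor two) Δ min))))
    (ℕ.m≤m*n (1664 ^ ℚ.↧ₙ r) (N ^ (6 * ℚ.↧ₙ r ℕ.+ ∣ ℚ.↥ r ∣))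
      {{ℕ.m^n≢0 N (6 * ℚ.↧ₙ r ℕ.+ ∣ ℚ.↥ r ∣) {{ℕ.≢-nonZero (Conductor.N≢0 E N conductor)}}}})
  where
  determined : (E : EllipticCurve ℚ-field) (N : ℕ) →
    HasNontrivialTorsion 7 E → IsConductor E N → IsTwoPrimeProduct N →
    IsMinimalDiscriminant E (- (+ (2 ^ 7 * 13))) ×
    ((Δ : ℤ) → IsMinimalDiscriminant E Δ → Δ ≡ - (+ (2 ^ 7 * 13)) × ∣ Δ ∣ < N ^ 3)
  determined E N torsion conductor two =
    let d , i = 7-torsion⇒tate E torsion
        T = tateModel (ℚ.↥ d) (ℚ.↧ d)
        ΔT = SevenTorsionCurve.Δ≡-1664 E d i N conductor two
    in (T , minimal-discriminant-1664 E T i ΔT , ΔT)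
     , λ where .(Δ W) (W , min , refl) →
                 let ΔW = unique-discriminant-1664 E T W i ΔT min in
                 ΔW , subst (λ x → ∣ x ∣ < N ^ 3) (sym ΔW)
                        (SevenTorsionCurve.1664<N³ E d i N conductor two)
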